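{- A WF net $M$ is an AND-OR net if and only if there is a one-node WF net $M'$ such that $M\leadsto^*M'$, where $\leadsto^*$ is the reflexive and transitive closure of the AND-OR contraction relation $\leadsto$.
   Context: **Nets.** A Petri net is a tuple $(P,T,F)$ with $P$ (places) and $T$ (transitions) finite disjoint sets and $F\subseteq (T\times P)\cup(P\times T)$ (edges). Elements of $P\cup T$ are nodes; the type of a node is "place" or "transition". For a node $a$: $\bullet a=\{b\mid (b,a)\in F\}$, $a\bullet=\{b\mid (a,b)\in F\}$. An I/O net is $N=(P,T,F,I,O)$ with $(P,T,F)$ a Petri net and $I,O\subseteq P\cup T$ non-empty (input nodes and output nodes). It is I/O consistent if $I\cup O\subseteq P$ or $I\cup O\subseteq T$. It is well-connected if every node is reachable by a directed path (possibly a single node) from some node of $I$, and from every node some node of $O$ is reachable. A WF net is an I/O net that is I/O consistent and well-connected; it is a pWF net if $I\cup O\subseteq P$ and a tWF net if $I\cup O\subseteq T$. Node names come from an infinite supply. **Basic AND-OR classes.** A WF net $(P,T,F,I,O)$ has the AND property if for every $p\in P$: ($p\in I$ and $|\bullet p|=0$, or $p\notin I$ and $|\bullet p|=1$) and ($p\in O$ and $|p\bullet|=0$, or $p\notin O$ and $|p\bullet|=1$). It has the OR property if the same holds with every transition $t\in T$ in the role of $p$. An AND net is an acyclic WF net with the AND property; an OR net is a WF net with the OR property. The basic AND-OR classes are: pAND (AND nets that are pWF nets), 11tAND (AND nets that are tWF nets with $|I|=|O|=1$), 11pOR (OR nets that are pWF nets with $|I|=|O|=1$), tOR (OR nets that are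 tWF nets). **Substitution and AND-OR nets.** Let $N=(P,T,F,I,O)$ and $L=(P',T',F',I',O')$ be WF nets with $(P\cup T)\cap(P'\cup T')=\emptyset$. If $x$ is a place of $N$ and $L$ is a pWF net (place substitution), or $x$ is a transition of $N$ and $L$ is a tWF net (transition substitution), then $N\otimes_xL$ is obtained from $N$ by removing $x$ and its edges, adding $L$ (its nodes and edges), and adding edges $(y,x')$ for all $y\in\bullet_Nx$, $x'\in I'$ and edges $(x',y)$ for all $x'\in O'$, $y\in x\bullet_N$. Its input set is $(I\setminus\{x\})\cup I'$ if $x\in I$ and $I$ otherwise; its output set is $(O\setminus\{x\})\cup O'$ if $x\in O$ and $O$ otherwise. The class of AND-OR nets is the smallest class of nets containing the four basic AND-OR classes and closed under place substitution and transition substitution (of disjoint nets both in the class). **Subnets.** A subnet of a WF net $M=(P_M,T_M,F_M,I_M,O_M)$ is a non-empty set $S\subseteq P_M\cup T_M$. Its associated net is $M[S]=(P_S,T_S,F_S,I_S,O_S)$ with $P_S=P_M\cap S$, $T_S=T_M\cap S$, $F_S=F_M\cap(S\times S)$, $I_S=(I_M\cap S)\cup\{n_2\in S\mid \exists n_1\in (P_M\cup T_M)\setminus S: (n_1,n_2)\in F_M\}$, $O_S=(O_M\cap S)\cup\{n_1\in S\mid \exists n_2\in (P_M\cup T_M)\setminus S: (n_1,n_2)\in F_M\}$. **Contraction.** If $M[S]$ is a pWF net (resp. tWF net), the result of contracting $S$ in $M$ into a new place (resp. transition) $n\notin P_M\cup T_M$ is $M'=(P_{M'},T_{M'},F_{M'},I_{M'},O_{M'})$,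 where $P_{M'}=(P_M\setminus S)\cup\{n\}$, $T_{M'}=T_M\setminus S$ (resp. $P_{M'}=P_M\setminus S$, $T_{M'}=(T_M\setminus S)\cup\{n\}$); $F_{M'}=\{(n_1,n_2)\in F_M\mid n_1,n_2\notin S\}\cup\{(n_1,n)\mid (n_1,n_2)\in F_M,n_1\notin S,n_2\in I_S\}\cup\{(n,n_2)\mid (n_1,n_2)\in F_M,n_1\in O_S,n_2\notin S\}$; $I_{M'}=I_M$ if $S\cap I_M=\emptyset$ and $(I_M\setminus S)\cup\{n\}$ otherwise; $O_{M'}=O_M$ if $S\cap O_M=\emptyset$ and $(O_M\setminus S)\cup\{n\}$ otherwise. **AND-OR contraction relation.** $S$ is well-nested in $M$ if for all $n_1,n_2\in I_S$: for every $n_3\notin S$, $(n_3,n_2)\in F_M$ implies $(n_3,n_1)\in F_M$, and $n_2\in I_M$ implies $n_1\in I_M$; and for all $n_1,n_2\in O_S$: for every $n_3\notin S$, $(n_2,n_3)\in F_M$ implies $(n_1,n_3)\in F_M$, and $n_2\in O_M$ implies $n_1\in O_M$. $S$ is AND-OR contractible in $M$ if $S$ is well-nested in $M$ and $M[S]$ is a WF net belonging to a basic AND-OR class. $M\leadsto M'$ means that some AND-OR contractible subnet of $M$ can be contracted with result $M'$. -}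

module Defs where

open import Data.Bool using (if_then_else_)
open import Data.List using (List; []; _∷_; _++_; map; filter; length; deduplicate; cartesianProduct)
open import Data.List.Membership.Propositional using (_∈_; _∉_)
import Data.List.Membership.DecPropositional as DecMembership
open import Data.List.Relation.Binary.BagAndSetEquality using (_∼[_]_; set)
open import Data.List.Relation.Binary.Disjoint.Propositional using (Disjoint)
open import Data.List.Relation.Binary.Subset.Propositional using (_⊆_)
open import Data.List.Relation.Unary.Any using (any?)
open import Data.Nat using (ℕ; _≟_)
open import Data.Product using (_×_; _,_; proj₁; proj₂; ∃-syntax)
open import Data.Product.Properties using (≡-dec)
open import Data.Sum using (_⊎_)
open import Relation.Binary.Construct.Closure.ReflexiveTransitive using (Star)
open import Relation.Binary.Construct.Closure.Transitive using (TransClosure)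
open import Relation.Binary.PropositionalEquality using (_≡_; _≢_)
open import Relation.Nullary using (¬_; ¬?; does; _×-dec_)

-- ℕ serves as the infinite supply of node names.  Finite sets are lists
-- read up to set equality: order and multiplicity carry no meaning.

Node : Set
Node = ℕ

Edge : Set
Edge = Node × Node

open DecMembership _≟_ using (_∈?_; _∉?_)
open DecMembership (≡-dec _≟_ _≟_) using () renaming (_∈?_ to _∈ᴱ?_)

infixl 7 _∩_
infixl 6 _∖_

_∩_ : List Node → List Node → List Node
xs ∩ ys = filter (_∈? ys) xs

_∖_ : List Node → List Node → List Node
xs ∖ ys = filter (_∉? ys) xs

-- Number of distinct elements.
card : List Node → ℕ
card xs = length (deduplicate _≟_ xs)

-- Only the data (P, T, F, I, O); the conditions that make it a Petri net,
-- an I/O net or a WF net are the predicates below.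
record Net : Set where
  constructor net
  field
    P : List Node
    T : List Node
    F : List Edge
    I : List Node
    O : List Node

open Net public

nodes : Net → List Node
nodes N = P N ++ T N

infix 4 _≈_

record _≈_ (M N : Net) : Set where
  field
    P≈ : P M ∼[ set ] P N
    T≈ : T M ∼[ set ] T N
    F≈ : F M ∼[ set ] F N
    I≈ : I M ∼[ set ] I N
    O≈ : O M ∼[ set ] O N

preset : Net → Node → List Node
preset N a = map proj₁ (filter (λ e → proj₂ e ≟ a) (F N))

postset : Net → Node → List Node
postset N a = map proj₂ (filter (λ e → proj₁ e ≟ a) (F N))

data NodeType : Set where
  place transition : NodeType

nodesOf : NodeType → Net → List Node
nodesOf place      = P
nodesOf transition = T

record IsPetriNet (N : Net) : Set where
  field
    disjoint  : Disjoint (P N) (T N)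
    bipartite : F N ⊆ cartesianProduct (T N) (P N) ++ cartesianProduct (P N) (T N)

record IsIONet (N : Net) : Set where
  field
    isPetriNet : IsPetriNet N
    I⊆nodes    : I N ⊆ nodes N
    O⊆nodes    : O N ⊆ nodes N
    I-nonEmpty : I N ≢ []
    O-nonEmpty : O N ≢ []

IOOfType : NodeType → Net → Set
IOOfType k N = I N ++ O N ⊆ nodesOf k N

IOConsistent : Net → Set
IOConsistent N = IOOfType place N ⊎ IOOfType transition N

Arrow : Net → Node → Node → Set
Arrow N a b = (a , b) ∈ F N

-- Star contains the empty sequence of edges, i.e. the single-node path.
Path : Net → Node → Node → Set
Path N = Star (Arrow N)

WellConnected : Net → Set
WellConnected N = ∀ {a} → a ∈ nodes N →
  (∃[ i ] (i ∈ I N × Path N i a)) × (∃[ o ] (o ∈ O N × Path N a o))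

record IsWF (N : Net) : Set where
  field
    isIONet       : IsIONet N
    ioConsistent  : IOConsistent N
    wellConnected : WellConnected N

-- pWF nets for k = place, tWF nets for k = transition.
IsWFOfType : NodeType → Net → Set
IsWFOfType k N = IsWF N × IOOfType k N

UniqueInOut : Net → Node → Set
UniqueInOut N a =
  ((a ∈ I N × card (preset N a) ≡ 0) ⊎ (a ∉ I N × card (preset N a) ≡ 1)) ×
  ((a ∈ O N × card (postset N a) ≡ 0) ⊎ (a ∉ O N × card (postset N a) ≡ 1))

ANDProperty : Net → Set
ANDProperty N = ∀ {p} → p ∈ P N → UniqueInOut N p

ORProperty : Net → Set
ORProperty N = ∀ {t} → t ∈ T N → UniqueInOut N t

Acyclic : Net → Set
Acyclic N = ∀ a → ¬ TransClosure (Arrow N) a a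

IsANDNet : Net → Set
IsANDNet N = IsWF N × Acyclic N × ANDProperty N

IsORNet : Net → Set
IsORNet N = IsWF N × ORProperty N

OneInOneOut : Net → Set
OneInOneOut N = card (I N) ≡ 1 × card (O N) ≡ 1

data IsBasic (N : Net) : Set where
  pAND   : IsANDNet N → IsWFOfType place N → IsBasic N
  11tAND : IsANDNet N → IsWFOfType transition N → OneInOneOut N → IsBasic N
  11pOR  : IsORNet N → IsWFOfType place N → OneInOneOut N → IsBasic N
  tOR    : IsORNet N → IsWFOfType transition N → IsBasic N

substIO : Node → List Node → List Node → List Node
substIO x new xs = if does (x ∈? xs) then (xs ∖ (x ∷ [])) ++ new else xs

_⊗[_]_ : Net → Node → Net → Net
N ⊗[ x ] L = net
  ((P N ∖ (x ∷ [])) ++ P L)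
  ((T N ∖ (x ∷ [])) ++ T L)
  (filter (λ e → ¬? (proj₁ e ≟ x) ×-dec ¬? (proj₂ e ≟ x)) (F N)
    ++ F L
    ++ cartesianProduct (preset N x) (I L)
    ++ cartesianProduct (O L) (postset N x))
  (substIO x (I L) (I N))
  (substIO x (O L) (O N))

-- The result of a substitution is taken up to _≈_, since lists only
-- represent sets; closure of the basic classes under _≈_ is automatic.
data IsANDOR : Net → Set where
  basic      : ∀ {N} → IsBasic N → IsANDOR N
  substitute : ∀ {N L M} (k : NodeType) (x : Node) →
               IsANDOR N → IsANDOR L →
               IsWF N → IsWFOfType k L →
               Disjoint (nodes N) (nodes L) →
               x ∈ nodesOf k N →
               M ≈ N ⊗[ x ] L →
               IsANDOR M

record IsSubnet (M : Net) (S : List Node) : Set where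
  field
    nonEmpty : S ≢ []
    S⊆nodes  : S ⊆ nodes M

subnetI : Net → List Node → List Node
subnetI M S = (I M ∩ S) ++
  filter (λ n₂ → any? (λ n₁ → (n₁ , n₂) ∈ᴱ? F M) (nodes M ∖ S)) S

subnetO : Net → List Node → List Node
subnetO M S = (O M ∩ S) ++
  filter (λ n₁ → any? (λ n₂ → (n₁ , n₂) ∈ᴱ? F M) (nodes M ∖ S)) S

_[_] : Net → List Node → Net
M [ S ] = net
  (P M ∩ S)
  (T M ∩ S)
  (filter (λ e → (proj₁ e ∈? S) ×-dec (proj₂ e ∈? S)) (F M))
  (subnetI M S)
  (subnetO M S)

contractF : List Node → Node → Net → List Edge
contractF S n M =
  filter (λ e → (proj₁ e ∉? S) ×-dec (proj₂ e ∉? S)) (F M)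
  ++ map (λ e → proj₁ e , n)
       (filter (λ e → (proj₁ e ∉? S) ×-dec (proj₂ e ∈? subnetI M S)) (F M))
  ++ map (λ e → n , proj₂ e)
       (filter (λ e → (proj₁ e ∈? subnetO M S) ×-dec (proj₂ e ∉? S)) (F M))

contractIO : List Node → Node → List Node → List Node
contractIO S n xs = if does (any? (_∈? S) xs) then n ∷ (xs ∖ S) else xs

contract : NodeType → List Node → Node → Net → Net
contract place S n M = net
  (n ∷ (P M ∖ S)) (T M ∖ S)
  (contractF S n M) (contractIO S n (I M)) (contractIO S n (O M))
contract transition S n M = net
  (P M ∖ S) (n ∷ (T M ∖ S))
  (contractF S n M) (contractIO S n (I M)) (contractIO S n (O M))

record WellNested (M : Net) (S : List Node) : Set where
  field
    inputs  : ∀ {n₁ n₂} → n₁ ∈ I (M [ S ]) → n₂ ∈ I (M [ S ]) →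
              (∀ {n₃} → n₃ ∉ S → (n₃ , n₂) ∈ F M → (n₃ , n₁) ∈ F M) ×
              (n₂ ∈ I M → n₁ ∈ I M)
    outputs : ∀ {n₁ n₂} → n₁ ∈ O (M [ S ]) → n₂ ∈ O (M [ S ]) →
              (∀ {n₃} → n₃ ∉ S → (n₂ , n₃) ∈ F M → (n₁ , n₃) ∈ F M) ×
              (n₂ ∈ O M → n₁ ∈ O M)

record IsContractible (M : Net) (S : List Node) : Set where
  field
    isSubnet   : IsSubnet M S
    wellNested : WellNested M S
    isBasic    : IsBasic (M [ S ])

infix 4 _⇝_ _⇝*_

data _⇝_ (M M′ : Net) : Set where
  step : (k : NodeType) (S : List Node) (n : Node) →
         IsWF M →
         IsContractible M S →
         IsWFOfType k (M [ S ]) →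
         n ∉ nodes M →
         M′ ≈ contract k S n M →
         M ⇝ M′

_⇝*_ : Net → Net → Set
_⇝*_ = Star _⇝_

OneNode : Net → Set
OneNode M = card (nodes M) ≡ 1

{-# OPTIONS --safe #-}
module Submission where

-- A contraction step undoes a substitution: if S is well-nested in M and M′ is
-- the contraction of S into n, then M = M′ ⊗[ n ] M[S].  Reading a reduction
-- backwards from a one-node net, which is basic, shows that M is an AND-OR net.
--
-- Conversely, if M = N ⊗[ x ] L with L an AND-OR net, then M ⇝* N, by induction
-- on L.  A basic L is well-nested in M and is contracted into x.  If
-- L = L₁ ⊗[ y ] L₂, then M = (N ⊗[ x ] L₁) ⊗[ y ] L₂ and the induction
-- hypothesis applies first to L₂ and then to L₁.  As y may occur in N, it is
-- first replaced by a fresh name, so the induction is over copies of L under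
-- maps that are injective on its nodes.  Taking for N a single node proves the
-- claim.

-- The definitions have separate clauses for edges, inputs and outputs, and give substitution and
-- contraction as list expressions. Both complications are removed once: each construction is
-- characterised by an inductive relation on nodes and environment, and later arguments only analyse
-- its constructors. Reversing all links exchanges inputs with outputs, so one argument serves both
-- sides of a net.
--
-- The obstacle in the forward direction is naming. The substituted node vanishes from the result of
-- a substitution, so nothing prevents its name from being reused in an enclosing net, and
-- regrouping nested substitutions fails on such a clash. Renaming the net itself would lose the
-- derivation of `IsANDOR` on which the recursion runs; so the derivation stays fixed, and only the
-- copy of its net inside the context is renamed.

open import Data.List using (List; []; _∷_; _++_; map; filter; cartesianProduct; length; deduplicate)
open import Data.List.Extrema.Nat using (max; xs≤max)
open import Data.List.Membership.Propositional using (_∈_; _∉_; find; lose)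
import Data.List.Membership.DecPropositional as DecMembership
open import Data.List.Membership.Propositional.Properties
open import Data.List.Relation.Binary.Disjoint.Propositional using (Disjoint)
open import Data.List.Relation.Binary.Subset.Propositional using (_⊆_)
import Data.List.Relation.Unary.All as Allᴸ
open import Data.List.Relation.Unary.Any using (here; there; any?)
open import Data.List.Relation.Unary.Unique.Propositional using (Unique; _∷_)
open import Data.Maybe as Maybe using (Maybe; just; nothing)
open import Data.Maybe.Properties using (just-injective) renaming (≡-dec to ≡-decᴹ)
open import Data.Maybe.Relation.Unary.All using (All; just; nothing)
open import Data.Nat using (suc; _≟_)
open import Data.Nat.Properties using (1+n≰n)
open import Data.List.Relation.Unary.Unique.DecPropositional.Properties _≟_ using (deduplicate-!)
open import Data.Product using (_×_; _,_; proj₁; proj₂; ∃-syntax; ∃₂; ∃!)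
open import Data.Product.Properties using (≡-dec)
open import Data.Sum using (_⊎_; inj₁; inj₂)
open import Data.Unit using (⊤; tt)
open import Function using (_∘_; flip)
open import Function.Bundles using (_⇔_; mk⇔; Equivalence)
open import Level using (0ℓ)
open import Relation.Binary using (Rel; _⇒_)
open import Relation.Binary.Construct.Closure.ReflexiveTransitive as Star using (Star; ε; _◅_; _◅◅_)
open import Relation.Binary.Construct.Closure.Transitive as Trans using (TransClosure; _∷_)
open import Relation.Binary.PropositionalEquality using (_≡_; _≢_; refl; sym; trans; cong; subst)
open import Relation.Nullary using (¬_; ¬?; yes; no; _×-dec_; contradiction)
open import Defs

open DecMembership _≟_ using (_∈?_; _∉?_)
open DecMembership (≡-dec _≟_ _≟_) using () renaming (_∈?_ to _∈ᴱ?_)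
open Equivalence using (to; from)

-- Nets as relations on nodes and environment

-- The environment of a net is treated as a further node, nothing: it has an
-- edge to every input and from every output.
data Link (M : Net) : Rel (Maybe Node) 0ℓ where
  arrow  : ∀ {a b} → (a , b) ∈ F M → Link M (just a) (just b)
  input  : ∀ {a} → a ∈ I M → Link M nothing (just a)
  output : ∀ {a} → a ∈ O M → Link M (just a) nothing

arrow⇔ : ∀ M {a b} → (a , b) ∈ F M ⇔ Link M (just a) (just b)
arrow⇔ _ = mk⇔ arrow λ { (arrow e) → e }

input⇔ : ∀ M {a} → a ∈ I M ⇔ Link M nothing (just a)
input⇔ _ = mk⇔ input λ { (input i) → i }

output⇔ : ∀ M {a} → a ∈ O M ⇔ Link M (just a) nothing
output⇔ _ = mk⇔ output λ { (output o) → o }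

-- Nets are lists read as sets, so only membership matters. A node predicate together with a link
-- relation is that extensional content: two nets with the same description are related by `_≈_`.
record Describes (V : NodeType → Node → Set) (R : Rel (Maybe Node) 0ℓ) (M : Net) : Set where
  constructor describes
  field
    node⇔ : ∀ k {a} → a ∈ nodesOf k M ⇔ V k a
    link⇔ : ∀ {c d} → Link M c d ⇔ R c d

  node⁻ : ∀ k {a} → a ∈ nodesOf k M → V k a
  node⁻ k = to (node⇔ k)
  node⁺ : ∀ k {a} → V k a → a ∈ nodesOf k M
  node⁺ k = from (node⇔ k)
  link⁻ : ∀ {c d} → Link M c d → R c d
  link⁻ = to link⇔
  link⁺ : ∀ {c d} → R c d → Link M c d
  link⁺ = from link⇔

open Describes

Models : Net → Net → Set
Models N = Describes (λ k a → a ∈ nodesOf k N) (Link N)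

≈⇒models : ∀ {M N} → M ≈ N → Models N M
≈⇒models {M} {N} M≈N = describes (λ k → mk⇔ (node→ k) (node← k)) (mk⇔ link→ link←)
  where
  open _≈_ M≈N
  node→ : ∀ k {a} → a ∈ nodesOf k M → a ∈ nodesOf k N
  node→ place      = to P≈
  node→ transition = to T≈
  node← : ∀ k {a} → a ∈ nodesOf k N → a ∈ nodesOf k M
  node← place      = from P≈
  node← transition = from T≈
  link→ : ∀ {c d} → Link M c d → Link N c d
  link→ (arrow e)  = arrow (to F≈ e)
  link→ (input i)  = input (to I≈ i)
  link→ (output o) = output (to O≈ o)
  link← : ∀ {c d} → Link N c d → Link M c d
  link← (arrow e)  = arrow (from F≈ e)
  link← (input i)  = input (from I≈ i)
  link← (output o) = output (from O≈ o)

models⇒≈ : ∀ {M N} → Models N M → M ≈ N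
models⇒≈ {M} {N} M⊨N = record
  { P≈ = node⇔ M⊨N place
  ; T≈ = node⇔ M⊨N transition
  ; F≈ = mk⇔ (from (arrow⇔ N) ∘ link⁻ M⊨N ∘ arrow) (from (arrow⇔ M) ∘ link⁺ M⊨N ∘ arrow)
  ; I≈ = mk⇔ (from (input⇔ N) ∘ link⁻ M⊨N ∘ input) (from (input⇔ M) ∘ link⁺ M⊨N ∘ input)
  ; O≈ = mk⇔ (from (output⇔ N) ∘ link⁻ M⊨N ∘ output) (from (output⇔ M) ∘ link⁺ M⊨N ∘ output)
  }

describes-resp : ∀ {V R M N} → Models N M → Describes V R N → Describes V R M
describes-resp M⊨N D = describes
  (λ k → mk⇔ (node⁻ D k ∘ node⁻ M⊨N k) (node⁺ M⊨N k ∘ node⁺ D k))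
  (mk⇔ (link⁻ D ∘ link⁻ M⊨N) (link⁺ M⊨N ∘ link⁺ D))

describes⇒models : ∀ {V R M N} → Describes V R M → Describes V R N → Models N M
describes⇒models DM DN = describes
  (λ k → mk⇔ (node⁺ DN k ∘ node⁻ DM k) (node⁺ DM k ∘ node⁻ DN k))
  (mk⇔ (link⁺ DN ∘ link⁻ DM) (link⁺ DM ∘ link⁻ DN))

nodesOf⊆nodes : ∀ k {M a} → a ∈ nodesOf k M → a ∈ nodes M
nodesOf⊆nodes place          = ∈-++⁺ˡ
nodesOf⊆nodes transition {M} = ∈-++⁺ʳ (P M)

nodes⊆nodesOf : ∀ M {a} → a ∈ nodes M → ∃[ k ] a ∈ nodesOf k M
nodes⊆nodesOf M a∈ with ∈-++⁻ (P M) a∈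
... | inj₁ p = place , p
... | inj₂ t = transition , t

just≢ : ∀ {a x : Node} → a ≢ x → _≢_ {A = Maybe Node} (just a) (just x)
just≢ a≢x refl = a≢x refl

≢just : ∀ {a x : Node} → _≢_ {A = Maybe Node} (just a) (just x) → a ≢ x
≢just ja≢jx refl = ja≢jx refl

∈-∖⁺ : ∀ {a xs ys} → a ∈ xs → a ∉ ys → a ∈ xs ∖ ys
∈-∖⁺ {ys = ys} = ∈-filter⁺ (_∉? ys)

∈-∖⁻ : ∀ {a} xs ys → a ∈ xs ∖ ys → a ∈ xs × a ∉ ys
∈-∖⁻ xs ys = ∈-filter⁻ (_∉? ys) {xs = xs}

∈-preset⁺ : ∀ {N a x} → (a , x) ∈ F N → a ∈ preset N x
∈-preset⁺ {x = x} e = ∈-map⁺ proj₁ (∈-filter⁺ (λ e → proj₂ e ≟ x) e refl)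

∈-preset⁻ : ∀ {N a x} → a ∈ preset N x → (a , x) ∈ F N
∈-preset⁻ {N} {x = x} p with ∈-map⁻ proj₁ p
... | _ , e∈ , refl with ∈-filter⁻ (λ e → proj₂ e ≟ x) {xs = F N} e∈
... | e , refl = e

∈-postset⁺ : ∀ {N a x} → (x , a) ∈ F N → a ∈ postset N x
∈-postset⁺ {x = x} e = ∈-map⁺ proj₂ (∈-filter⁺ (λ e → proj₁ e ≟ x) e refl)

∈-postset⁻ : ∀ {N a x} → a ∈ postset N x → (x , a) ∈ F N
∈-postset⁻ {N} {x = x} p with ∈-map⁻ proj₂ p
... | _ , e∈ , refl with ∈-filter⁻ (λ e → proj₁ e ≟ x) {xs = F N} e∈
... | e , refl = e

data SubstNode (V W : NodeType → Node → Set) (x : Node) (k : NodeType) (a : Node) : Set where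
  old : V k a → a ≢ x → SubstNode V W x k a
  new : W k a → SubstNode V W x k a

-- Since the far end of `enter` and `leave` may be `nothing`, these constructors account at once for
-- the edges added around `x` and for the inputs and outputs that replace `x`. Like `_⊗[_]_` they do
-- not exclude `x` as far end; in a bipartite net `x` has no loop.
data SubstLink (R Q : Rel (Maybe Node) 0ℓ) (x : Node) : Rel (Maybe Node) 0ℓ where
  outer : ∀ {c d} → R c d → c ≢ just x → d ≢ just x → SubstLink R Q x c d
  inner : ∀ {a b} → Q (just a) (just b) → SubstLink R Q x (just a) (just b)
  enter : ∀ {c a} → R c (just x) → Q nothing (just a) → SubstLink R Q x c (just a)
  leave : ∀ {a d} → Q (just a) nothing → R (just x) d → SubstLink R Q x (just a) d

SubstShape : Net → Node → Net → Net → Set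
SubstShape N x L = Describes (SubstNode (λ k a → a ∈ nodesOf k N) (λ k a → a ∈ nodesOf k L) x)
                             (SubstLink (Link N) (Link L) x)

∈-∖-++⁺ : ∀ {x a} {xs ys : List Node} → (a ∈ xs × a ≢ x) ⊎ a ∈ ys → a ∈ (xs ∖ (x ∷ [])) ++ ys
∈-∖-++⁺ (inj₁ (a∈ , a≢x)) = ∈-++⁺ˡ (∈-∖⁺ a∈ λ { (here a≡x) → a≢x a≡x })
∈-∖-++⁺ {x} {xs = xs} (inj₂ a∈) = ∈-++⁺ʳ (xs ∖ (x ∷ [])) a∈

∈-∖-++⁻ : ∀ {x a} {xs ys : List Node} → a ∈ (xs ∖ (x ∷ [])) ++ ys → (a ∈ xs × a ≢ x) ⊎ a ∈ ys
∈-∖-++⁻ {x} {xs = xs} a∈ with ∈-++⁻ (xs ∖ (x ∷ [])) a∈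
... | inj₂ a∈ys = inj₂ a∈ys
... | inj₁ a∈xs with ∈-∖⁻ xs (x ∷ []) a∈xs
... | a∈ , a∉ = inj₁ (a∈ , λ a≡x → a∉ (here a≡x))

substIO⁺ : ∀ x ys xs {a} → (a ∈ xs × a ≢ x) ⊎ (x ∈ xs × a ∈ ys) → a ∈ substIO x ys xs
substIO⁺ x ys xs a∈ with x ∈? xs
substIO⁺ x ys xs (inj₁ a∈)         | yes _ = ∈-∖-++⁺ (inj₁ a∈)
substIO⁺ x ys xs (inj₂ (_ , a∈))   | yes _ = ∈-∖-++⁺ {xs = xs} (inj₂ a∈)
substIO⁺ x ys xs (inj₁ (a∈ , _))   | no _  = a∈
substIO⁺ x ys xs (inj₂ (x∈ , _))   | no x∉ = contradiction x∈ x∉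

substIO⁻ : ∀ x ys xs {a} → a ∈ substIO x ys xs → (a ∈ xs × a ≢ x) ⊎ (x ∈ xs × a ∈ ys)
substIO⁻ x ys xs a∈ with x ∈? xs
... | no x∉ = inj₁ (a∈ , λ { refl → x∉ a∈ })
... | yes x∈ with ∈-∖-++⁻ {xs = xs} a∈
...   | inj₁ a∈xs = inj₁ a∈xs
...   | inj₂ a∈ys = inj₂ (x∈ , a∈ys)

⊗-shape : ∀ N x L → SubstShape N x L (N ⊗[ x ] L)
⊗-shape N x L = describes (λ k → mk⇔ (node→ k) (node← k)) (mk⇔ link→ link←)
  where
  node→ : ∀ k {a} → a ∈ nodesOf k (N ⊗[ x ] L) →
          SubstNode (λ k a → a ∈ nodesOf k N) (λ k a → a ∈ nodesOf k L) x k a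
  node→ place a∈ with ∈-∖-++⁻ {xs = P N} a∈
  ... | inj₁ (p , q) = old p q
  ... | inj₂ p = new p
  node→ transition a∈ with ∈-∖-++⁻ {xs = T N} a∈
  ... | inj₁ (p , q) = old p q
  ... | inj₂ p = new p
  node← : ∀ k {a} → SubstNode (λ k a → a ∈ nodesOf k N) (λ k a → a ∈ nodesOf k L) x k a →
          a ∈ nodesOf k (N ⊗[ x ] L)
  node← place (old a∈ a≢x) = ∈-∖-++⁺ (inj₁ (a∈ , a≢x))
  node← place (new a∈) = ∈-∖-++⁺ {xs = P N} (inj₂ a∈)
  node← transition (old a∈ a≢x) = ∈-∖-++⁺ (inj₁ (a∈ , a≢x))
  node← transition (new a∈) = ∈-∖-++⁺ {xs = T N} (inj₂ a∈)

  x≢? = λ (e : Edge) → ¬? (proj₁ e ≟ x) ×-dec ¬? (proj₂ e ≟ x)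
  link→ : ∀ {c d} → Link (N ⊗[ x ] L) c d → SubstLink (Link N) (Link L) x c d
  link→ (arrow e) with ∈-++⁻ (filter x≢? (F N)) e
  ... | inj₁ e′ with ∈-filter⁻ x≢? {xs = F N} e′
  ...   | e″ , a≢x , b≢x = outer (arrow e″) (just≢ a≢x) (just≢ b≢x)
  link→ (arrow e) | inj₂ e′ with ∈-++⁻ (F L) e′
  ... | inj₁ e″ = inner (arrow e″)
  ... | inj₂ e″ with ∈-++⁻ (cartesianProduct (preset N x) (I L)) e″
  ...   | inj₁ p with ∈-cartesianProduct⁻ (preset N x) (I L) p
  ...     | a∈ , b∈ = enter (arrow (∈-preset⁻ {N} a∈)) (input b∈)
  link→ (arrow e) | inj₂ e′ | inj₂ e″ | inj₂ p with ∈-cartesianProduct⁻ (O L) (postset N x) p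
  ... | a∈ , b∈ = leave (output a∈) (arrow (∈-postset⁻ {N} b∈))
  link→ (input a∈) with substIO⁻ x (I L) (I N) a∈
  ... | inj₁ (i , a≢x) = outer (input i) (λ ()) (just≢ a≢x)
  ... | inj₂ (i , j) = enter (input i) (input j)
  link→ (output a∈) with substIO⁻ x (O L) (O N) a∈
  ... | inj₁ (i , a≢x) = outer (output i) (just≢ a≢x) (λ ())
  ... | inj₂ (i , j) = leave (output j) (output i)

  link← : ∀ {c d} → SubstLink (Link N) (Link L) x c d → Link (N ⊗[ x ] L) c d
  link← (outer (arrow e) c≢ d≢) = arrow (∈-++⁺ˡ (∈-filter⁺ x≢? e (≢just c≢ , ≢just d≢)))
  link← (outer (input i) _ d≢) = input (substIO⁺ x (I L) (I N) (inj₁ (i , ≢just d≢)))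
  link← (outer (output o) c≢ _) = output (substIO⁺ x (O L) (O N) (inj₁ (o , ≢just c≢)))
  link← (inner (arrow e)) = arrow (∈-++⁺ʳ (filter x≢? (F N)) (∈-++⁺ˡ e))
  link← (enter (arrow e) (input i)) = arrow (∈-++⁺ʳ (filter x≢? (F N)) (∈-++⁺ʳ (F L)
    (∈-++⁺ˡ (∈-cartesianProduct⁺ (∈-preset⁺ {N} e) i))))
  link← (enter (input j) (input i)) = input (substIO⁺ x (I L) (I N) (inj₂ (j , i)))
  link← (leave (output o) (arrow e)) = arrow (∈-++⁺ʳ (filter x≢? (F N)) (∈-++⁺ʳ (F L)
    (∈-++⁺ʳ (cartesianProduct (preset N x) (I L)) (∈-cartesianProduct⁺ o (∈-postset⁺ {N} e)))))
  link← (leave (output o) (output p)) = output (substIO⁺ x (O L) (O N) (inj₂ (p , o)))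

-- `All` over `Maybe` holds at `nothing`, so the environment counts as outside `S`. Hence `entry`
-- covers both reasons for being an input of a subnet: being an input of the net, or having a
-- predecessor outside `S`. Likewise `exit` for outputs.
data RestrictLink (S : List Node) (R : Rel (Maybe Node) 0ℓ) : Rel (Maybe Node) 0ℓ where
  within : ∀ {a b} → R (just a) (just b) → a ∈ S → b ∈ S → RestrictLink S R (just a) (just b)
  entry  : ∀ {c a} → R c (just a) → All (_∉ S) c → a ∈ S → RestrictLink S R nothing (just a)
  exit   : ∀ {a d} → R (just a) d → a ∈ S → All (_∉ S) d → RestrictLink S R (just a) nothing

data ContractNode (S : List Node) (n : Node) (t : NodeType) (V : NodeType → Node → Set) :
                  NodeType → Node → Set where
  kept   : ∀ {k a} → V k a → a ∉ S → ContractNode S n t V k a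
  merged : ContractNode S n t V t n

data ContractLink (S : List Node) (n : Node) (R : Rel (Maybe Node) 0ℓ) : Rel (Maybe Node) 0ℓ where
  outer : ∀ {c d} → R c d → All (_∉ S) c → All (_∉ S) d → ContractLink S n R c d
  enter : ∀ {c a} → R c (just a) → All (_∉ S) c → a ∈ S → ContractLink S n R c (just n)
  leave : ∀ {a d} → R (just a) d → a ∈ S → All (_∉ S) d → ContractLink S n R (just n) d

-- `subnetI` and `subnetO` look for neighbours only among the nodes outside `S`, whereas an edge of
-- an arbitrary `Net` may have any number as an end. The two agree when edges end in nodes.
EndsInNodes : Net → Set
EndsInNodes M = ∀ {a b} → (a , b) ∈ F M → a ∈ nodes M × b ∈ nodes M

∈-∩⁺ : ∀ {a xs} ys → a ∈ xs → a ∈ ys → a ∈ xs ∩ ys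
∈-∩⁺ ys = ∈-filter⁺ (_∈? ys)

∈-∩⁻ : ∀ {a} xs ys → a ∈ xs ∩ ys → a ∈ xs × a ∈ ys
∈-∩⁻ xs ys = ∈-filter⁻ (_∈? ys) {xs = xs}

contractIO⁻ : ∀ S n xs {a} → a ∈ contractIO S n xs →
              (a ∈ xs × a ∉ S) ⊎ (a ≡ n × ∃[ s ] (s ∈ xs × s ∈ S))
contractIO⁻ S n xs a∈ with any? (_∈? S) xs
... | no ¬s = inj₁ (a∈ , λ s → ¬s (lose a∈ s))
contractIO⁻ S n xs (here refl) | yes s = inj₂ (refl , find s)
contractIO⁻ S n xs (there a∈)  | yes s = inj₁ (∈-∖⁻ xs S a∈)

contractIO-kept : ∀ S n xs {a} → a ∈ xs → a ∉ S → a ∈ contractIO S n xs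
contractIO-kept S n xs a∈ a∉ with any? (_∈? S) xs
... | no _  = a∈
... | yes _ = there (∈-∖⁺ a∈ a∉)

contractIO-merged : ∀ S n xs {a} → a ∈ xs → a ∈ S → n ∈ contractIO S n xs
contractIO-merged S n xs a∈ s with any? (_∈? S) xs
... | no ¬s = contradiction (lose a∈ s) ¬s
... | yes _ = here refl

module _ {M : Net} (ends : EndsInNodes M) (S : List Node) where

  private
    inS?    = λ (e : Edge) → (proj₁ e ∈? S) ×-dec (proj₂ e ∈? S)
    outS?   = λ (e : Edge) → (proj₁ e ∉? S) ×-dec (proj₂ e ∉? S)
    enterS? = λ (e : Edge) → (proj₁ e ∉? S) ×-dec (proj₂ e ∈? subnetI M S)
    leaveS? = λ (e : Edge) → (proj₁ e ∈? subnetO M S) ×-dec (proj₂ e ∉? S)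
    pred?   = λ n₂ → any? (λ n₁ → (n₁ , n₂) ∈ᴱ? F M) (nodes M ∖ S)
    succ?   = λ n₁ → any? (λ n₂ → (n₁ , n₂) ∈ᴱ? F M) (nodes M ∖ S)

  subnetI⁻ : ∀ {a} → a ∈ subnetI M S → RestrictLink S (Link M) nothing (just a)
  subnetI⁻ a∈ with ∈-++⁻ (I M ∩ S) a∈
  ... | inj₁ a∈I with ∈-∩⁻ (I M) S a∈I
  ...   | i , s = entry (input i) nothing s
  subnetI⁻ a∈ | inj₂ a∈′ with ∈-filter⁻ pred? {xs = S} a∈′
  ... | s , p with find p
  ...   | b , b∈ , e = entry (arrow e) (just (proj₂ (∈-∖⁻ (nodes M) S b∈))) s

  subnetI⁺ : ∀ {c a} → Link M c (just a) → All (_∉ S) c → a ∈ S → a ∈ subnetI M S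
  subnetI⁺ (arrow e) (just b∉) s =
    ∈-++⁺ʳ (I M ∩ S) (∈-filter⁺ pred? s (lose (∈-∖⁺ (proj₁ (ends e)) b∉) e))
  subnetI⁺ (input i) nothing s = ∈-++⁺ˡ (∈-∩⁺ S i s)

  subnetO⁻ : ∀ {a} → a ∈ subnetO M S → RestrictLink S (Link M) (just a) nothing
  subnetO⁻ a∈ with ∈-++⁻ (O M ∩ S) a∈
  ... | inj₁ a∈O with ∈-∩⁻ (O M) S a∈O
  ...   | o , s = exit (output o) s nothing
  subnetO⁻ a∈ | inj₂ a∈′ with ∈-filter⁻ succ? {xs = S} a∈′
  ... | s , p with find p
  ...   | b , b∈ , e = exit (arrow e) s (just (proj₂ (∈-∖⁻ (nodes M) S b∈)))

  subnetO⁺ : ∀ {a d} → Link M (just a) d → a ∈ S → All (_∉ S) d → a ∈ subnetO M S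
  subnetO⁺ (arrow e) s (just b∉) =
    ∈-++⁺ʳ (O M ∩ S) (∈-filter⁺ succ? s (lose (∈-∖⁺ (proj₂ (ends e)) b∉) e))
  subnetO⁺ (output o) s nothing = ∈-++⁺ˡ (∈-∩⁺ S o s)

  restrict-shape : Describes (λ k a → a ∈ nodesOf k M × a ∈ S) (RestrictLink S (Link M)) (M [ S ])
  restrict-shape = describes (λ k → mk⇔ (node→ k) (node← k)) (mk⇔ link→ link←)
    where
    node→ : ∀ k {a} → a ∈ nodesOf k (M [ S ]) → a ∈ nodesOf k M × a ∈ S
    node→ place      = ∈-∩⁻ (P M) S
    node→ transition = ∈-∩⁻ (T M) S
    node← : ∀ k {a} → a ∈ nodesOf k M × a ∈ S → a ∈ nodesOf k (M [ S ])
    node← place      (a∈ , s) = ∈-∩⁺ S a∈ s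
    node← transition (a∈ , s) = ∈-∩⁺ S a∈ s
    link→ : ∀ {c d} → Link (M [ S ]) c d → RestrictLink S (Link M) c d
    link→ (arrow e) with ∈-filter⁻ inS? {xs = F M} e
    ... | e′ , a∈ , b∈ = within (arrow e′) a∈ b∈
    link→ (input i)  = subnetI⁻ i
    link→ (output o) = subnetO⁻ o
    link← : ∀ {c d} → RestrictLink S (Link M) c d → Link (M [ S ]) c d
    link← (within (arrow e) a∈ b∈) = arrow (∈-filter⁺ inS? e (a∈ , b∈))
    link← (entry l c∉ a∈) = input (subnetI⁺ l c∉ a∈)
    link← (exit l a∈ d∉)  = output (subnetO⁺ l a∈ d∉)

  contract-shape : ∀ t n → Describes (ContractNode S n t (λ k a → a ∈ nodesOf k M))
                                     (ContractLink S n (Link M)) (contract t S n M)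
  contract-shape t n = describes (λ k → mk⇔ (node→ t k) (node← t k)) (mk⇔ (link→ t) (link← t))
    where
    node→ : ∀ t k {a} → a ∈ nodesOf k (contract t S n M) → ContractNode S n t (λ k a → a ∈ nodesOf k M) k a
    node→ place      place      (here refl) = merged
    node→ place      place      (there a∈)  = let a∈ , a∉ = ∈-∖⁻ (P M) S a∈ in kept a∈ a∉
    node→ place      transition a∈          = let a∈ , a∉ = ∈-∖⁻ (T M) S a∈ in kept a∈ a∉
    node→ transition transition (here refl) = merged
    node→ transition transition (there a∈)  = let a∈ , a∉ = ∈-∖⁻ (T M) S a∈ in kept a∈ a∉
    node→ transition place      a∈          = let a∈ , a∉ = ∈-∖⁻ (P M) S a∈ in kept a∈ a∉
    node← : ∀ t k {a} → ContractNode S n t (λ k a → a ∈ nodesOf k M) k a → a ∈ nodesOf k (contract t S n M)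
    node← place      .place      merged       = here refl
    node← transition .transition merged       = here refl
    node← place      place      (kept a∈ a∉) = there (∈-∖⁺ a∈ a∉)
    node← place      transition (kept a∈ a∉) = ∈-∖⁺ a∈ a∉
    node← transition place      (kept a∈ a∉) = ∈-∖⁺ a∈ a∉
    node← transition transition (kept a∈ a∉) = there (∈-∖⁺ a∈ a∉)

    F→ : ∀ {a b} → (a , b) ∈ contractF S n M → ContractLink S n (Link M) (just a) (just b)
    F→ e with ∈-++⁻ (filter outS? (F M)) e
    ... | inj₁ e′ with ∈-filter⁻ outS? {xs = F M} e′
    ...   | e″ , a∉ , b∉ = outer (arrow e″) (just a∉) (just b∉)
    F→ e | inj₂ e′ with ∈-++⁻ (map (λ e → proj₁ e , n) (filter enterS? (F M))) e′
    ... | inj₁ p with ∈-map⁻ (λ e → proj₁ e , n) p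
    ...   | _ , q , refl with ∈-filter⁻ enterS? {xs = F M} q
    ...     | e″ , a∉ , b∈ = enter (arrow e″) (just a∉) (∈S b∈)
      where
      ∈S : ∀ {b} → b ∈ subnetI M S → b ∈ S
      ∈S b∈ with subnetI⁻ b∈
      ... | entry _ _ s = s
    F→ e | inj₂ e′ | inj₂ p with ∈-map⁻ (λ e → n , proj₂ e) p
    ... | _ , q , refl with ∈-filter⁻ leaveS? {xs = F M} q
    ...   | e″ , a∈ , b∉ = leave (arrow e″) (∈S a∈) (just b∉)
      where
      ∈S : ∀ {a} → a ∈ subnetO M S → a ∈ S
      ∈S a∈ with subnetO⁻ a∈
      ... | exit _ s _ = s

    F← : ∀ {a b} → ContractLink S n (Link M) (just a) (just b) → (a , b) ∈ contractF S n M
    F← (outer (arrow e) (just a∉) (just b∉)) = ∈-++⁺ˡ (∈-filter⁺ outS? e (a∉ , b∉))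
    F← (enter (arrow e) (just a∉) s) = ∈-++⁺ʳ (filter outS? (F M)) (∈-++⁺ˡ
      (∈-map⁺ (λ e → proj₁ e , n) (∈-filter⁺ enterS? e (a∉ , subnetI⁺ (arrow e) (just a∉) s))))
    F← (leave (arrow e) s (just b∉)) = ∈-++⁺ʳ (filter outS? (F M))
      (∈-++⁺ʳ (map (λ e → proj₁ e , n) (filter enterS? (F M)))
      (∈-map⁺ (λ e → n , proj₂ e) (∈-filter⁺ leaveS? e (subnetO⁺ (arrow e) s (just b∉) , b∉))))

    I→ : ∀ {a} → a ∈ contractIO S n (I M) → ContractLink S n (Link M) nothing (just a)
    I→ a∈ with contractIO⁻ S n (I M) a∈
    ... | inj₁ (i , a∉) = outer (input i) nothing (just a∉)
    ... | inj₂ (refl , _ , i , s) = enter (input i) nothing s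

    I← : ∀ {a} → ContractLink S n (Link M) nothing (just a) → a ∈ contractIO S n (I M)
    I← (outer (input i) _ (just a∉)) = contractIO-kept S n (I M) i a∉
    I← (enter (input i) _ s) = contractIO-merged S n (I M) i s

    O→ : ∀ {a} → a ∈ contractIO S n (O M) → ContractLink S n (Link M) (just a) nothing
    O→ a∈ with contractIO⁻ S n (O M) a∈
    ... | inj₁ (o , a∉) = outer (output o) (just a∉) nothing
    ... | inj₂ (refl , _ , o , s) = leave (output o) s nothing

    O← : ∀ {a} → ContractLink S n (Link M) (just a) nothing → a ∈ contractIO S n (O M)
    O← (outer (output o) (just a∉) _) = contractIO-kept S n (O M) o a∉
    O← (leave (output o) s _) = contractIO-merged S n (O M) o s

    link→ : ∀ t {c d} → Link (contract t S n M) c d → ContractLink S n (Link M) c d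
    link→ place      (arrow e)  = F→ e
    link→ place      (input i)  = I→ i
    link→ place      (output o) = O→ o
    link→ transition (arrow e)  = F→ e
    link→ transition (input i)  = I→ i
    link→ transition (output o) = O→ o

    link← : ∀ t {c d} → ContractLink S n (Link M) c d → Link (contract t S n M) c d
    link← t          {nothing} {nothing} (outer () _ _)
    link← place      {just _}  {just _}  l = arrow (F← l)
    link← place      {nothing} {just _}  l = input (I← l)
    link← place      {just _}  {nothing} l = output (O← l)
    link← transition {just _}  {just _}  l = arrow (F← l)
    link← transition {nothing} {just _}  l = input (I← l)
    link← transition {just _}  {nothing} l = output (O← l)

-- Well-formed nets

opposite : NodeType → NodeType
opposite place      = transition
opposite transition = place

opposite-involutive : ∀ k → opposite (opposite k) ≡ k
opposite-involutive place      = refl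
opposite-involutive transition = refl

opposite-≢ : ∀ k → k ≢ opposite k
opposite-≢ place      ()
opposite-≢ transition ()

lastStep : ∀ {A : Set} {R : Rel A 0ℓ} {a b} → Star R a b → a ≡ b ⊎ ∃[ c ] R c b
lastStep ε = inj₁ refl
lastStep (r ◅ p) with lastStep p
... | inj₁ refl = inj₂ (_ , r)
... | inj₂ q    = inj₂ q

-- Giving the environment of a net with inputs and outputs of type k the
-- opposite type turns I/O consistency into bipartiteness of Link.
HasType : NodeType → Net → NodeType → Maybe Node → Set
HasType k M t nothing  = t ≡ opposite k
HasType k M t (just a) = a ∈ nodesOf t M

-- The type of inputs and outputs, a disjunction in `IsWF`, becomes the parameter `k`.
-- Coreachability is a walk along reversed links that starts at the environment like reachability,
-- so a single argument applied to `Link M` and to its flip proves both.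
record WellFormed (k : NodeType) (M : Net) : Set where
  field
    disjoint    : ∀ s t {a} → a ∈ nodesOf s M → a ∈ nodesOf t M → s ≡ t
    bipartite   : ∀ {c d} → Link M c d → ∃[ t ] (HasType k M t c × HasType k M (opposite t) d)
    hasInput    : ∃[ a ] Link M nothing (just a)
    hasOutput   : ∃[ a ] Link M (just a) nothing
    reachable   : ∀ t {a} → a ∈ nodesOf t M → Star (Link M) nothing (just a)
    coreachable : ∀ t {a} → a ∈ nodesOf t M → Star (flip (Link M)) nothing (just a)

  source∈ : ∀ {a d} → Link M (just a) d → a ∈ nodes M
  source∈ l = let t , a∈ , _ = bipartite l in nodesOf⊆nodes t a∈

  target∈ : ∀ {c a} → Link M c (just a) → a ∈ nodes M
  target∈ l = let t , _ , a∈ = bipartite l in nodesOf⊆nodes (opposite t) a∈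

  irreflexive : ∀ {a} → ¬ Link M (just a) (just a)
  irreflexive l = let t , a∈ , a∈′ = bipartite l in opposite-≢ t (disjoint _ _ a∈ a∈′)

  endsInNodes : EndsInNodes M
  endsInNodes e = source∈ (arrow e) , target∈ (arrow e)

  inputType : ∀ {a} → Link M nothing (just a) → a ∈ nodesOf k M
  inputType l with bipartite l
  ... | t , refl , a∈ = subst (λ s → _ ∈ nodesOf s M) (opposite-involutive k) a∈

  outputType : ∀ {a} → Link M (just a) nothing → a ∈ nodesOf k M
  outputType {a} l with bipartite l
  ... | t , a∈ , eq = subst (λ s → a ∈ nodesOf s M)
    (trans (sym (opposite-involutive t)) (trans (cong opposite eq) (opposite-involutive k))) a∈

  -- A walk from `nothing` to a node cannot be empty. The link obtained is what makes the inputs of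
  -- a net substituted for `a` inputs of the corresponding subnet.
  predecessor : ∀ t {a} → a ∈ nodesOf t M → ∃[ c ] Link M c (just a)
  predecessor t a∈ with lastStep (reachable t a∈)
  ... | inj₂ l = l

  successor : ∀ t {a} → a ∈ nodesOf t M → ∃[ d ] Link M (just a) d
  successor t a∈ with lastStep (coreachable t a∈)
  ... | inj₂ l = l

module _ {k : NodeType} {M : Net} where

  open WellFormed

  wellFormed⁺ : IsWFOfType k M → WellFormed k M
  wellFormed⁺ (wf , io) = record
    { disjoint = disj
    ; bipartite = bip
    ; hasInput = nonEmpty (I M) (IsIONet.I-nonEmpty ioNet) (λ a → input a)
    ; hasOutput = nonEmpty (O M) (IsIONet.O-nonEmpty ioNet) (λ a → output a)
    ; reachable = λ t a∈ → let _ , i , p = proj₁ (IsWF.wellConnected wf (nodesOf⊆nodes t a∈))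
                           in input i ◅ Star.gmap just arrow p
    ; coreachable = λ t a∈ → let _ , o , p = proj₂ (IsWF.wellConnected wf (nodesOf⊆nodes t a∈))
                             in output o ◅ Star.reverse (λ l → l) (Star.gmap just arrow p)
    }
    where
    ioNet = IsWF.isIONet wf
    petri = IsIONet.isPetriNet ioNet
    disj : ∀ s t {a} → a ∈ nodesOf s M → a ∈ nodesOf t M → s ≡ t
    disj place      place      _ _ = refl
    disj transition transition _ _ = refl
    disj place      transition p q = contradiction (p , q) (IsPetriNet.disjoint petri)
    disj transition place      p q = contradiction (q , p) (IsPetriNet.disjoint petri)
    bip : ∀ {c d} → Link M c d → ∃[ t ] (HasType k M t c × HasType k M (opposite t) d)
    bip (arrow e) with ∈-++⁻ (cartesianProduct (T M) (P M)) (IsPetriNet.bipartite petri e)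
    ... | inj₁ tp = transition , ∈-cartesianProduct⁻ (T M) (P M) tp
    ... | inj₂ pt = place , ∈-cartesianProduct⁻ (P M) (T M) pt
    bip (input {a} i) = opposite k , refl ,
      subst (λ s → a ∈ nodesOf s M) (sym (opposite-involutive k)) (io (∈-++⁺ˡ i))
    bip (output o) = k , io (∈-++⁺ʳ (I M) o) , refl
    nonEmpty : ∀ {Q : Node → Set} xs → xs ≢ [] → (∀ {a} → a ∈ xs → Q a) → ∃[ a ] Q a
    nonEmpty []      ne _ = contradiction refl ne
    nonEmpty (x ∷ _) _  q = x , q (here refl)

  wellFormed⁻ : WellFormed k M → IsWFOfType k M
  wellFormed⁻ wf = record
    { isIONet = record
      { isPetriNet = record
        { disjoint = λ { (p , t) → place≢transition (disjoint wf place transition p t) }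
        ; bipartite = bip
        }
      ; I⊆nodes = target∈ wf ∘ input
      ; O⊆nodes = source∈ wf ∘ output
      ; I-nonEmpty = nonEmpty (in∈I (proj₂ (hasInput wf)))
      ; O-nonEmpty = nonEmpty (out∈O (proj₂ (hasOutput wf)))
      }
    ; ioConsistent = consistent k io
    ; wellConnected = λ a∈ → let t , a∈t = nodes⊆nodesOf M a∈ in
        pathFrom (reachable wf t a∈t) , pathTo (Star.reverse (λ l → l) (coreachable wf t a∈t))
    } , io
    where
    place≢transition : place ≢ transition
    place≢transition ()
    in∈I : ∀ {a} → Link M nothing (just a) → a ∈ I M
    in∈I (input i) = i
    out∈O : ∀ {a} → Link M (just a) nothing → a ∈ O M
    out∈O (output o) = o
    nonEmpty : ∀ {a} {xs : List Node} → a ∈ xs → xs ≢ []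
    nonEmpty (here _)  ()
    nonEmpty (there _) ()
    io : IOOfType k M
    io a∈ with ∈-++⁻ (I M) a∈
    ... | inj₁ i = inputType wf (input i)
    ... | inj₂ o = outputType wf (output o)
    consistent : ∀ k → IOOfType k M → IOConsistent M
    consistent place      = inj₁
    consistent transition = inj₂
    bip : ∀ {e} → e ∈ F M → e ∈ cartesianProduct (T M) (P M) ++ cartesianProduct (P M) (T M)
    bip e with bipartite wf (arrow e)
    ... | place      , a∈ , b∈ = ∈-++⁺ʳ (cartesianProduct (T M) (P M)) (∈-cartesianProduct⁺ a∈ b∈)
    ... | transition , a∈ , b∈ = ∈-++⁺ˡ (∈-cartesianProduct⁺ a∈ b∈)
    -- A walk in `Link` may pass through the environment and come back by another input. Only the
    -- part after the last visit is a path of the net, so an input found later in the walk takes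
    -- precedence.
    prefix : ∀ {c a} → Star (Link M) c (just a) →
             (∃[ b ] (c ≡ just b × Path M b a)) ⊎ ∃[ i ] (i ∈ I M × Path M i a)
    prefix ε = inj₁ (_ , refl , ε)
    prefix (arrow e ◅ p) with prefix p
    ... | inj₁ (_ , refl , q) = inj₁ (_ , refl , e ◅ q)
    ... | inj₂ q = inj₂ q
    prefix (input i ◅ p) with prefix p
    ... | inj₁ (_ , refl , q) = inj₂ (_ , i , q)
    ... | inj₂ q = inj₂ q
    prefix (output _ ◅ p) with prefix p
    ... | inj₂ q = inj₂ q
    pathFrom : ∀ {a} → Star (Link M) nothing (just a) → ∃[ i ] (i ∈ I M × Path M i a)
    pathFrom p with prefix p
    ... | inj₂ q = q
    -- Dually, the walk is cut at its first visit to the environment.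
    pathTo : ∀ {a} → Star (Link M) (just a) nothing → ∃[ o ] (o ∈ O M × Path M a o)
    pathTo (arrow e ◅ p)  = let o , o∈ , q = pathTo p in o , o∈ , e ◅ q
    pathTo (output o ◅ _) = _ , o , ε

isWF⇒wellFormed : ∀ {M} → IsWF M → ∃[ k ] WellFormed k M
isWF⇒wellFormed wf with IsWF.ioConsistent wf
... | inj₁ io = place , wellFormed⁺ (wf , io)
... | inj₂ io = transition , wellFormed⁺ (wf , io)

-- Cardinality zero and one

card≡0⁺ : ∀ xs → (∀ {a} → a ∉ xs) → card xs ≡ 0
card≡0⁺ []       _ = refl
card≡0⁺ (x ∷ xs) e = contradiction (here refl) e

card≡0⁻ : ∀ xs {a} → card xs ≡ 0 → a ∉ xs
card≡0⁻ xs eq a∈ with deduplicate _≟_ xs | ∈-deduplicate⁺ _≟_ a∈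
card≡0⁻ xs () a∈ | _ ∷ _ | _

card≡1⁺ : ∀ xs {a} → a ∈ xs → (∀ {b} → b ∈ xs → a ≡ b) → card xs ≡ 1
card≡1⁺ xs a∈ eq = single (deduplicate-! xs) (∈-deduplicate⁺ _≟_ a∈) (λ b∈ → eq (∈-deduplicate⁻ _≟_ xs b∈))
  where
  single : ∀ {ys a} → Unique ys → a ∈ ys → (∀ {b} → b ∈ ys → a ≡ b) → length ys ≡ 1
  single {_ ∷ []}    _ _ _ = refl
  single {_ ∷ _ ∷ _} ((x≢y Allᴸ.∷ _) ∷ _) _ e =
    contradiction (trans (sym (e (here refl))) (e (there (here refl)))) x≢y

card≡1⁻ : ∀ xs → card xs ≡ 1 → ∃! _≡_ (_∈ xs)
card≡1⁻ xs eq with deduplicate _≟_ xs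
                 | (λ {a} → ∈-deduplicate⁻ _≟_ xs {a})
                 | (λ {a} → ∈-deduplicate⁺ _≟_ {xs = xs} {a})
... | a ∷ [] | d⁻ | d⁺ = a , d⁻ (here refl) , λ b∈ → lemma (d⁺ b∈)
  where
  lemma : ∀ {b} → b ∈ a ∷ [] → a ≡ b
  lemma (here eq) = sym eq
card≡1⁻ xs () | _ ∷ _ ∷ _ | _ | _

-- Copies and basic nets

-- The two alternatives on each side of `UniqueInOut` coincide once the environment counts as a
-- node: there is exactly one incoming and one outgoing link. In this form the AND and OR properties
-- pass easily to copies.
UniqueLinks : Net → Node → Set
UniqueLinks M a = ∃! _≡_ (λ c → Link M c (just a)) × ∃! _≡_ (Link M (just a))

uniqueLinks⁺ : ∀ {M a} → UniqueInOut M a → UniqueLinks M a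
uniqueLinks⁺ {M} {a} (ins , outs) = in⁺ ins , out⁺ outs
  where
  in⁺ : (a ∈ I M × card (preset M a) ≡ 0) ⊎ (a ∉ I M × card (preset M a) ≡ 1) →
        ∃! _≡_ (λ c → Link M c (just a))
  in⁺ (inj₁ (i , none)) = nothing , input i , λ
    { (arrow e) → contradiction (∈-preset⁺ {M} e) (card≡0⁻ _ none) ; (input _) → refl }
  in⁺ (inj₂ (¬i , one)) with card≡1⁻ _ one
  ... | b , b∈ , uniq = just b , arrow (∈-preset⁻ {M} b∈) , λ
    { (arrow e) → cong just (uniq (∈-preset⁺ {M} e)) ; (input i) → contradiction i ¬i }
  out⁺ : (a ∈ O M × card (postset M a) ≡ 0) ⊎ (a ∉ O M × card (postset M a) ≡ 1) →
         ∃! _≡_ (Link M (just a))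
  out⁺ (inj₁ (o , none)) = nothing , output o , λ
    { (arrow e) → contradiction (∈-postset⁺ {M} e) (card≡0⁻ _ none) ; (output _) → refl }
  out⁺ (inj₂ (¬o , one)) with card≡1⁻ _ one
  ... | b , b∈ , uniq = just b , arrow (∈-postset⁻ {M} b∈) , λ
    { (arrow e) → cong just (uniq (∈-postset⁺ {M} e)) ; (output o) → contradiction o ¬o }

uniqueLinks⁻ : ∀ {M a} → UniqueLinks M a → UniqueInOut M a
uniqueLinks⁻ {M} {a} (ins , outs) = in⁻ ins , out⁻ outs
  where
  in⁻ : ∃! _≡_ (λ c → Link M c (just a)) →
        (a ∈ I M × card (preset M a) ≡ 0) ⊎ (a ∉ I M × card (preset M a) ≡ 1)
  in⁻ (nothing , input i , uniq) =
    inj₁ (i , card≡0⁺ _ λ b∈ → contradiction (uniq (arrow (∈-preset⁻ {M} b∈))) λ ())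
  in⁻ (just b , arrow e , uniq) =
    inj₂ ((λ i → contradiction (uniq (input i)) λ ()) ,
          card≡1⁺ _ (∈-preset⁺ {M} e) λ b∈ → just-injective (uniq (arrow (∈-preset⁻ {M} b∈))))
  out⁻ : ∃! _≡_ (Link M (just a)) →
         (a ∈ O M × card (postset M a) ≡ 0) ⊎ (a ∉ O M × card (postset M a) ≡ 1)
  out⁻ (nothing , output o , uniq) =
    inj₁ (o , card≡0⁺ _ λ b∈ → contradiction (uniq (arrow (∈-postset⁻ {M} b∈))) λ ())
  out⁻ (just b , arrow e , uniq) =
    inj₂ ((λ o → contradiction (uniq (output o)) λ ()) ,
          card≡1⁺ _ (∈-postset⁺ {M} e) λ b∈ → just-injective (uniq (arrow (∈-postset⁻ {M} b∈))))

CopyNode : (Node → Node) → Net → NodeType → Node → Set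
CopyNode f L k a = ∃[ b ] (b ∈ nodesOf k L × a ≡ f b)

CopyLink : (Node → Node) → Net → Rel (Maybe Node) 0ℓ
CopyLink f L c d = ∃₂ λ c₀ d₀ → Link L c₀ d₀ × c ≡ Maybe.map f c₀ × d ≡ Maybe.map f d₀

InjectiveOn : (Node → Node) → List Node → Set
InjectiveOn f xs = ∀ {a b} → a ∈ xs → b ∈ xs → f a ≡ f b → a ≡ b

-- `f` is constrained only on the nodes of `L`, so its value at any other name may be changed. `K`
-- is described and not equated with `rename f L`, so that it may also be a subnet of a larger net.
record Copy (f : Node → Node) (L K : Net) : Set where
  field
    injective : InjectiveOn f (nodes L)
    shape     : Describes (CopyNode f L) (CopyLink f L) K

  copyNode : ∀ k {a} → a ∈ nodesOf k L → f a ∈ nodesOf k K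
  copyNode k a∈ = node⁺ shape k (_ , a∈ , refl)

  copyLink : ∀ {c d} → Link L c d → Link K (Maybe.map f c) (Maybe.map f d)
  copyLink l = link⁺ shape (_ , _ , l , refl , refl)

rename : (Node → Node) → Net → Net
rename f L = net (map f (P L)) (map f (T L)) (map (λ e → f (proj₁ e) , f (proj₂ e)) (F L))
                 (map f (I L)) (map f (O L))

rename-copy : ∀ {f L} → InjectiveOn f (nodes L) → Copy f L (rename f L)
rename-copy {f} {L} inj = record
  { injective = inj
  ; shape = describes (λ k → mk⇔ (node→ k) (node← k)) (mk⇔ link→ link←)
  }
  where
  node→ : ∀ k {a} → a ∈ nodesOf k (rename f L) → CopyNode f L k a
  node→ place      = ∈-map⁻ f
  node→ transition = ∈-map⁻ f
  node← : ∀ k {a} → CopyNode f L k a → a ∈ nodesOf k (rename f L)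
  node← place      (_ , b∈ , refl) = ∈-map⁺ f b∈
  node← transition (_ , b∈ , refl) = ∈-map⁺ f b∈
  link→ : ∀ {c d} → Link (rename f L) c d → CopyLink f L c d
  link→ (arrow e) with ∈-map⁻ (λ e → f (proj₁ e) , f (proj₂ e)) e
  ... | _ , e₀ , refl = _ , _ , arrow e₀ , refl , refl
  link→ (input i) with ∈-map⁻ f i
  ... | _ , i₀ , refl = _ , _ , input i₀ , refl , refl
  link→ (output o) with ∈-map⁻ f o
  ... | _ , o₀ , refl = _ , _ , output o₀ , refl , refl
  link← : ∀ {c d} → CopyLink f L c d → Link (rename f L) c d
  link← (_ , _ , arrow e  , refl , refl) = arrow (∈-map⁺ (λ e → f (proj₁ e) , f (proj₂ e)) e)
  link← (_ , _ , input i  , refl , refl) = input (∈-map⁺ f i)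
  link← (_ , _ , output o , refl , refl) = output (∈-map⁺ f o)

copy-refl : ∀ {L} → Copy (λ a → a) L L
copy-refl {L} = record
  { injective = λ _ _ eq → eq
  ; shape = describes (λ k → mk⇔ (λ a∈ → _ , a∈ , refl) (node← k)) (mk⇔ link→ link←)
  }
  where
  node← : ∀ k {a} → CopyNode (λ a → a) L k a → a ∈ nodesOf k L
  node← k (_ , a∈ , refl) = a∈
  link→ : ∀ {c d} → Link L c d → CopyLink (λ a → a) L c d
  -- The link is split only to make `Maybe.map` compute at its ends.
  link→ l@(arrow _)  = _ , _ , l , refl , refl
  link→ l@(input _)  = _ , _ , l , refl , refl
  link→ l@(output _) = _ , _ , l , refl , refl
  link← : ∀ {c d} → CopyLink (λ a → a) L c d → Link L c d
  link← (_ , _ , l@(arrow _)  , refl , refl) = l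
  link← (_ , _ , l@(input _)  , refl , refl) = l
  link← (_ , _ , l@(output _) , refl , refl) = l

copy-resp : ∀ {f L K K′} → Models K K′ → Copy f L K → Copy f L K′
copy-resp K′⊨K cp = record { injective = Copy.injective cp ; shape = describes-resp K′⊨K (Copy.shape cp) }

module _ {f : Node → Node} {L K : Net} (cp : Copy f L K) where

  open Copy cp
  open WellFormed

  copy-wellFormed : ∀ {k} → WellFormed k L → WellFormed k K
  copy-wellFormed {k} wf = record
    { disjoint = disj
    ; bipartite = bip
    ; hasInput = _ , copyLink (proj₂ (hasInput wf))
    ; hasOutput = _ , copyLink (proj₂ (hasOutput wf))
    ; reachable = reach
    ; coreachable = coreach
    }
    where
    disj : ∀ s t {a} → a ∈ nodesOf s K → a ∈ nodesOf t K → s ≡ t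
    disj s t a∈s a∈t with node⁻ shape s a∈s | node⁻ shape t a∈t
    ... | b , b∈s , refl | b′ , b′∈t , eq
      with refl ← injective (nodesOf⊆nodes s b∈s) (nodesOf⊆nodes t b′∈t) eq = disjoint wf s t b∈s b′∈t
    typed : ∀ t c → HasType k L t c → HasType k K t (Maybe.map f c)
    typed t nothing  eq = eq
    typed t (just a) a∈ = copyNode t a∈
    bip : ∀ {c d} → Link K c d → ∃[ t ] (HasType k K t c × HasType k K (opposite t) d)
    bip l with link⁻ shape l
    ... | c , d , l₀ , refl , refl = let t , p , q = bipartite wf l₀ in t , typed t c p , typed (opposite t) d q
    reach : ∀ t {a} → a ∈ nodesOf t K → Star (Link K) nothing (just a)
    reach t a∈ with node⁻ shape t a∈
    ... | _ , b∈ , refl = Star.gmap (Maybe.map f) copyLink (reachable wf t b∈)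
    coreach : ∀ t {a} → a ∈ nodesOf t K → Star (flip (Link K)) nothing (just a)
    coreach t a∈ with node⁻ shape t a∈
    ... | _ , b∈ , refl = Star.gmap (Maybe.map f) copyLink (coreachable wf t b∈)

  module _ {k : NodeType} (wf : WellFormed k L) where

    -- The description yields a link of `L` from some `a′` with `f a′` equal to `f a`. Links of a
    -- well-formed net end in nodes, so injectivity applies and identifies `a′` with `a`.
    source⁻ : ∀ {a d} → a ∈ nodes L → Link K (just (f a)) d →
              ∃[ d₀ ] (Link L (just a) d₀ × d ≡ Maybe.map f d₀)
    source⁻ a∈ l with link⁻ shape l
    ... | just a′ , d₀ , l₀ , eq , refl
      with refl ← injective a∈ (source∈ wf l₀) (just-injective eq) = d₀ , l₀ , refl

    target⁻ : ∀ {c a} → a ∈ nodes L → Link K c (just (f a)) →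
              ∃[ c₀ ] (Link L c₀ (just a) × c ≡ Maybe.map f c₀)
    target⁻ a∈ l with link⁻ shape l
    ... | c₀ , just a′ , l₀ , refl , eq
      with refl ← injective a∈ (target∈ wf l₀) (just-injective eq) = c₀ , l₀ , refl

    copy-uniqueLinks : ∀ {a} → a ∈ nodes L → UniqueLinks L a → UniqueLinks K (f a)
    copy-uniqueLinks a∈ ((c , l , uniqᶜ) , (d , m , uniqᵈ)) =
      (_ , copyLink l , λ l′ → let _ , l₀ , eq = target⁻ a∈ l′ in trans (cong (Maybe.map f) (uniqᶜ l₀)) (sym eq)) ,
      (_ , copyLink m , λ m′ → let _ , m₀ , eq = source⁻ a∈ m′ in trans (cong (Maybe.map f) (uniqᵈ m₀)) (sym eq))

    copy-uniqueInOut : ∀ t → (∀ {a} → a ∈ nodesOf t L → UniqueInOut L a) →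
                             (∀ {a} → a ∈ nodesOf t K → UniqueInOut K a)
    copy-uniqueInOut t uniq a∈ with node⁻ shape t a∈
    ... | b , b∈ , refl =
      uniqueLinks⁻ (copy-uniqueLinks (nodesOf⊆nodes t b∈) (uniqueLinks⁺ (uniq b∈)))

    copy-acyclic : Acyclic L → Acyclic K
    copy-acyclic acyc a cycle with lift cycle
      where
      -- Each edge of a path in `K` lifts separately. Consecutive lifts meet only up to `f`, and
      -- injectivity glues them; it also closes the lifted cycle afterwards.
      lift : ∀ {a b} → TransClosure (Arrow K) a b →
             ∃₂ λ a₀ b₀ → a ≡ f a₀ × b ≡ f b₀ × a₀ ∈ nodes L × b₀ ∈ nodes L × TransClosure (Arrow L) a₀ b₀
      lift Trans.[ e ] with link⁻ shape (arrow e)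
      ... | _ , _ , arrow e₀ , refl , refl =
        _ , _ , refl , refl , source∈ wf (arrow e₀) , target∈ wf (arrow e₀) , Trans.[ e₀ ]
      lift (e ∷ p) with link⁻ shape (arrow e) | lift p
      ... | _ , _ , arrow e₀ , refl , refl | _ , _ , eq , refl , a∈ , b∈ , q
        with refl ← injective (target∈ wf (arrow e₀)) a∈ eq =
          _ , _ , refl , refl , source∈ wf (arrow e₀) , b∈ , e₀ ∷ q
    ... | a₀ , b₀ , refl , eq , a∈ , b∈ , p with refl ← injective a∈ b∈ eq = acyc a₀ p

    copy-oneInOneOut : OneInOneOut L → OneInOneOut K
    copy-oneInOneOut (one-in , one-out) with card≡1⁻ (I L) one-in | card≡1⁻ (O L) one-out
    ... | i , i∈ , uniqᵢ | o , o∈ , uniqₒ =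
      card≡1⁺ (I K) (from (input⇔ K) (copyLink (input i∈)))
        (λ b∈ → copied-input (link⁻ shape (input b∈))) ,
      card≡1⁺ (O K) (from (output⇔ K) (copyLink (output o∈)))
        (λ b∈ → copied-output (link⁻ shape (output b∈)))
      where
      copied-input : ∀ {b} → CopyLink f L nothing (just b) → f i ≡ b
      copied-input (_ , _ , input j , refl , refl) = cong f (uniqᵢ j)
      copied-output : ∀ {b} → CopyLink f L (just b) nothing → f o ≡ b
      copied-output (_ , _ , output j , refl , refl) = cong f (uniqₒ j)

  -- Serves twice in a contraction: along the renaming, from the given net to its copy, and along
  -- the identity, from that copy to the subnet it forms.
  copy-basic : IsBasic L → IsBasic K
  copy-basic (pAND (_ , acyc , uniq) t) with wf ← wellFormed⁺ {place} t =
    let k = wellFormed⁻ {place} (copy-wellFormed wf) in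
    pAND (proj₁ k , copy-acyclic wf acyc , copy-uniqueInOut wf place uniq) k
  copy-basic (11tAND (_ , acyc , uniq) t one) with wf ← wellFormed⁺ {transition} t =
    let k = wellFormed⁻ {transition} (copy-wellFormed wf) in
    11tAND (proj₁ k , copy-acyclic wf acyc , copy-uniqueInOut wf place uniq) k (copy-oneInOneOut wf one)
  copy-basic (11pOR (_ , uniq) t one) with wf ← wellFormed⁺ {place} t =
    let k = wellFormed⁻ {place} (copy-wellFormed wf) in
    11pOR (proj₁ k , copy-uniqueInOut wf transition uniq) k (copy-oneInOneOut wf one)
  copy-basic (tOR (_ , uniq) t) with wf ← wellFormed⁺ {transition} t =
    let k = wellFormed⁻ {transition} (copy-wellFormed wf) in
    tOR (proj₁ k , copy-uniqueInOut wf transition uniq) k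

models⇒copy : ∀ {M N} → Models N M → Copy (λ a → a) N M
models⇒copy M⊨N = copy-resp M⊨N copy-refl

-- Substitution

-- Reversal exchanges `enter` and `leave`; through it the reachability argument below also gives
-- coreachability.
subst-flip : ∀ {R Q : Rel (Maybe Node) 0ℓ} {x c d} →
             SubstLink (flip R) (flip Q) x c d → SubstLink R Q x d c
subst-flip (outer r c≢ d≢) = outer r d≢ c≢
subst-flip (inner q)       = inner q
subst-flip (enter r q)     = leave q r
subst-flip (leave q r)     = enter r q

module _ {R Q W : Rel (Maybe Node) 0ℓ} {x : Node} (embed : ∀ {c d} → SubstLink R Q x c d → W c d) where

  Reached : Maybe Node → Set
  Reached = Star W nothing

  -- A walk in `Q` may return to the environment, where nothing is carried over (`⊤`); each re-entry
  -- is justified afresh by `start`.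
  reach-inner : (∀ {a} → Q nothing (just a) → Reached (just a)) →
                ∀ {a} → Star Q nothing (just a) → Reached (just a)
  reach-inner start p = Star.fold (λ c d → Reachedᴸ c → Reachedᴸ d) (λ q f s → f (next q s)) (λ s → s) p tt
    where
    Reachedᴸ : Maybe Node → Set
    Reachedᴸ nothing  = ⊤
    Reachedᴸ (just a) = Reached (just a)
    next : ∀ {c d} → Q c d → Reachedᴸ c → Reachedᴸ d
    next {_}       {nothing} _ _ = tt
    next {nothing} {just _}  q _ = start q
    next {just _}  {just _}  q s = s ◅◅ embed (inner q) ◅ ε

  module _ {o} (out : Q (just o) nothing) (reach-o : Star Q nothing (just o)) where

    Reachedᴺ : Maybe Node → Set
    Reachedᴺ c = (c ≢ just x → Reached c) × (c ≡ just x → ∀ {a} → Q nothing (just a) → Reached (just a))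

    -- The substitution removes `x`, so the invariant there is that all inputs of the inserted net
    -- are reached. To go on from `x`, the walk crosses the inserted net to `o`; one output
    -- suffices, since `leave` joins it to every successor of `x`.
    reach-outer : ∀ {c} → Star R nothing c → Reachedᴺ c
    reach-outer p = Star.fold (λ c d → Reachedᴺ c → Reachedᴺ d) (λ r f s → f (next r s)) (λ s → s) p
                      ((λ _ → ε) , λ ())
      where
      next : ∀ {c d} → R c d → Reachedᴺ c → Reachedᴺ d
      next {c} r (away , at) with ≡-decᴹ _≟_ c (just x)
      ... | no c≢x = (λ d≢x → away c≢x ◅◅ embed (outer r c≢x d≢x) ◅ ε)
                   , λ { refl q → away c≢x ◅◅ embed (enter r q) ◅ ε }
      ... | yes refl = (λ _ → after ◅◅ embed (leave out r) ◅ ε)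
                     -- For a loop at `x`, the far end of both new links is `x` itself.
                     , λ { refl q → after ◅◅ embed (leave out r) ◅ embed (enter r q) ◅ ε }
        where after = reach-inner (at refl) reach-o

module _ {N x L M} (shape : SubstShape N x L M) {j k} (wfN : WellFormed j N) (wfL : WellFormed k L)
         (x∈ : x ∈ nodesOf k N) (disj : Disjoint (nodes N) (nodes L)) where

  open WellFormed

  private
    reaches : ∀ t {a} → a ∈ nodesOf t M → Star (Link M) nothing (just a)
    reaches t a∈ = case (node⁻ shape t a∈)
      where
      o = hasOutput wfL
      outside = reach-outer (link⁺ shape) (proj₂ o)
        (reachable wfL k (outputType wfL (proj₂ o)))
      case : ∀ {a} → SubstNode (λ k a → a ∈ nodesOf k N) (λ k a → a ∈ nodesOf k L) x t a →
             Star (Link M) nothing (just a)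
      case (old a∈ a≢x) = proj₁ (outside (reachable wfN t a∈)) (just≢ a≢x)
      case (new a∈) = reach-inner (link⁺ shape) (proj₂ (outside (reachable wfN k x∈)) refl) (reachable wfL t a∈)

    coreaches : ∀ t {a} → a ∈ nodesOf t M → Star (flip (Link M)) nothing (just a)
    coreaches t a∈ = case (node⁻ shape t a∈)
      where
      i = hasInput wfL
      back : ∀ {c d} → SubstLink (flip (Link N)) (flip (Link L)) x c d → flip (Link M) c d
      back l = link⁺ shape (subst-flip l)
      outside = reach-outer back (proj₂ i) (coreachable wfL k (inputType wfL (proj₂ i)))
      case : ∀ {a} → SubstNode (λ k a → a ∈ nodesOf k N) (λ k a → a ∈ nodesOf k L) x t a →
             Star (flip (Link M)) nothing (just a)
      case (old a∈ a≢x) = proj₁ (outside (coreachable wfN t a∈)) (just≢ a≢x)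
      case (new a∈) = reach-inner back (proj₂ (outside (coreachable wfN k x∈)) refl) (coreachable wfL t a∈)

  -- The result has the type of `N` even when `x` is an input or output of `N`: then `x` has type
  -- `j`, and so have the inputs and outputs of `L` that replace it.
  subst-wellFormed : WellFormed j M
  subst-wellFormed = record
    { disjoint = λ s t a∈s a∈t → same s t (node⁻ shape s a∈s) (node⁻ shape t a∈t)
    ; bipartite = λ l → bip (link⁻ shape l)
    ; hasInput = in⁺ (hasInput wfN)
    ; hasOutput = out⁺ (hasOutput wfN)
    ; reachable = reaches
    ; coreachable = coreaches
    }
    where
    V : NodeType → Node → Set
    V = SubstNode (λ k a → a ∈ nodesOf k N) (λ k a → a ∈ nodesOf k L) x
    same : ∀ s t {a} → V s a → V t a → s ≡ t
    same s t (old p _) (old q _) = disjoint wfN s t p q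
    same s t (new p)   (new q)   = disjoint wfL s t p q
    same s t (old p _) (new q)   = contradiction (nodesOf⊆nodes s p , nodesOf⊆nodes t q) disj
    same s t (new p)   (old q _) = contradiction (nodesOf⊆nodes t q , nodesOf⊆nodes s p) disj
    typed : ∀ t {c} → HasType j N t c → c ≢ just x → HasType j M t c
    typed t {nothing} eq _   = eq
    typed t {just a} a∈ c≢x = node⁺ shape t (old a∈ (≢just c≢x))
    bip : ∀ {c d} → SubstLink (Link N) (Link L) x c d → ∃[ t ] (HasType j M t c × HasType j M (opposite t) d)
    bip (outer r c≢ d≢) with bipartite wfN r
    ... | t , p , q = t , typed t p c≢ , typed (opposite t) q d≢
    bip (inner r) with bipartite wfL r
    ... | t , p , q = t , node⁺ shape t (new p) , node⁺ shape (opposite t) (new q)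
    -- Bipartiteness of `N` gives `x` the type `opposite t`. As `x` also has type `k`, the two are
    -- equal, and an input of `L` has the type needed at the end of the new link.
    bip {c} (enter r i) with bipartite wfN r
    ... | t , p , q = t , typed t p (λ { refl → irreflexive wfN r }) ,
      node⁺ shape (opposite t)
        (new (subst (λ s → _ ∈ nodesOf s L) (disjoint wfN k (opposite t) x∈ q) (inputType wfL i)))
    bip (leave o r) with bipartite wfN r
    ... | t , p , q = t ,
      node⁺ shape t (new (subst (λ s → _ ∈ nodesOf s L) (disjoint wfN k t x∈ p) (outputType wfL o))) ,
      typed (opposite t) q (λ { refl → irreflexive wfN r })
    in⁺ : ∃[ a ] Link N nothing (just a) → ∃[ a ] Link M nothing (just a)
    in⁺ (a , i) with a ≟ x
    ... | no a≢x   = a , link⁺ shape (outer i (λ ()) (just≢ a≢x))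
    ... | yes refl = _ , link⁺ shape (enter i (proj₂ (hasInput wfL)))
    out⁺ : ∃[ a ] Link N (just a) nothing → ∃[ a ] Link M (just a) nothing
    out⁺ (a , o) with a ≟ x
    ... | no a≢x   = a , link⁺ shape (outer o (just≢ a≢x) (λ ()))
    ... | yes refl = _ , link⁺ shape (leave (proj₂ (hasOutput wfL)) o)

-- A derivation records that the outer net is WF but not its type. Substitution preserves the type
-- of the outer net, and any input of the result determines the type of the result, so `j′` and `j`
-- agree.
outerType : ∀ {N x L M j j′ k} → SubstShape N x L M → WellFormed j M → WellFormed j′ N → WellFormed k L →
            x ∈ nodesOf k N → Disjoint (nodes N) (nodes L) → WellFormed j N
outerType {N} {x} {M = M} {j} {j′} {k} shape wfM wfN wfL x∈ disj = subst (λ t → WellFormed t N) j′≡j wfN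
  where
  open WellFormed
  j′≡j : j′ ≡ j
  j′≡j with hasInput (subst-wellFormed shape wfN wfL x∈ disj)
  ... | _ , i = disjoint wfM _ _ (inputType (subst-wellFormed shape wfN wfL x∈ disj) i) (inputType wfM i)

fresh : (xs : List Node) → ∃[ z ] z ∉ xs
fresh xs = suc (max 0 xs) , λ z∈ → 1+n≰n (Allᴸ.lookup (xs≤max 0 xs) z∈)

substShape⇒≈ : ∀ {N x L M} → SubstShape N x L M → M ≈ N ⊗[ x ] L
substShape⇒≈ {N} {x} {L} shape = models⇒≈ (describes⇒models shape (⊗-shape N x L))

≈⇒substShape : ∀ {N x L M} → M ≈ N ⊗[ x ] L → SubstShape N x L M
≈⇒substShape {N} {x} {L} M≈ = describes-resp (≈⇒models M≈) (⊗-shape N x L)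

SubstLink-map : ∀ {R R′ Q Q′ : Rel (Maybe Node) 0ℓ} {x} → R ⇒ R′ → Q ⇒ Q′ →
                SubstLink R Q x ⇒ SubstLink R′ Q′ x
SubstLink-map f g (outer r c≢ d≢) = outer (f r) c≢ d≢
SubstLink-map f g (inner q)       = inner (g q)
SubstLink-map f g (enter r q)     = enter (f r) (g q)
SubstLink-map f g (leave q r)     = leave (g q) (f r)

module _ {R Q W : Rel (Maybe Node) 0ℓ} {x z : Node}
         (z∉R : ∀ {c d} → R c d → c ≢ just z × d ≢ just z) where

  -- Both sides make the same two replacements, except that the right one would also replace `z`
  -- where it occurs in the outer net; `z∉R` excludes this. In the converse it refutes the cases in
  -- which a link of `R` meets `z`.
  SubstLink-assocˡ : SubstLink R (SubstLink Q W z) x ⇒ SubstLink (SubstLink R Q x) W z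
  SubstLink-assocˡ (outer r c≢ d≢) = outer (outer r c≢ d≢) (proj₁ (z∉R r)) (proj₂ (z∉R r))
  SubstLink-assocˡ (inner (outer q a≢ b≢)) = outer (inner q) a≢ b≢
  SubstLink-assocˡ (inner (inner w)) = inner w
  SubstLink-assocˡ (inner (enter q w)) = enter (inner q) w
  SubstLink-assocˡ (inner (leave w q)) = leave w (inner q)
  SubstLink-assocˡ (enter r (outer q _ a≢)) = outer (enter r q) (proj₁ (z∉R r)) a≢
  SubstLink-assocˡ (enter r (enter q w)) = enter (enter r q) w
  SubstLink-assocˡ (leave (outer q a≢ _) r) = outer (leave q r) a≢ (proj₂ (z∉R r))
  SubstLink-assocˡ (leave (leave w q) r) = leave w (leave q r)

  SubstLink-assocʳ : SubstLink (SubstLink R Q x) W z ⇒ SubstLink R (SubstLink Q W z) x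
  SubstLink-assocʳ (outer (outer r c≢ d≢) _ _) = outer r c≢ d≢
  SubstLink-assocʳ (outer (inner q) a≢ b≢) = inner (outer q a≢ b≢)
  SubstLink-assocʳ (outer (enter r q) _ a≢) = enter r (outer q (λ ()) a≢)
  SubstLink-assocʳ (outer (leave q r) a≢ _) = leave (outer q a≢ (λ ())) r
  SubstLink-assocʳ (inner w) = inner (inner w)
  SubstLink-assocʳ (enter (outer r _ _) w) = contradiction refl (proj₂ (z∉R r))
  SubstLink-assocʳ (enter (inner q) w) = inner (enter q w)
  SubstLink-assocʳ (enter (enter r q) w) = enter r (enter q w)
  SubstLink-assocʳ (enter (leave q r) w) = contradiction refl (proj₂ (z∉R r))
  SubstLink-assocʳ (leave w (outer r _ _)) = contradiction refl (proj₁ (z∉R r))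
  SubstLink-assocʳ (leave w (inner q)) = inner (leave w q)
  SubstLink-assocʳ (leave w (enter r q)) = contradiction refl (proj₁ (z∉R r))
  SubstLink-assocʳ (leave w (leave q r)) = leave (leave w q) r

subst-assoc : ∀ {N K K₁ K₂ M N′ x z j} → WellFormed j N → z ∉ nodes N →
              SubstShape N x K M → SubstShape K₁ z K₂ K → SubstShape N x K₁ N′ → SubstShape N′ z K₂ M
subst-assoc {N} {K} {K₁} {K₂} {M} {N′} {x} {z} wfN z∉ M≐ K≐ N′≐ =
  describes (λ k → mk⇔ (node→ k ∘ node⁻ M≐ k) (node⁺ M≐ k ∘ node← k))
    (mk⇔ (SubstLink-map (link⁺ N′≐) (λ l → l) ∘ SubstLink-assocˡ ends
            ∘ SubstLink-map (λ l → l) (link⁻ K≐) ∘ link⁻ M≐)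
         (link⁺ M≐ ∘ SubstLink-map (λ l → l) (link⁺ K≐)
            ∘ SubstLink-assocʳ ends ∘ SubstLink-map (link⁻ N′≐) (λ l → l)))
  where
  V : Net → NodeType → Node → Set
  V N k a = a ∈ nodesOf k N
  ends : ∀ {c d} → Link N c d → c ≢ just z × d ≢ just z
  ends l = (λ { refl → z∉ (WellFormed.source∈ wfN l) }) , (λ { refl → z∉ (WellFormed.target∈ wfN l) })
  node→ : ∀ k {a} → SubstNode (V N) (V K) x k a → SubstNode (V N′) (V K₂) z k a
  node→ k (old a∈ a≢x) = old (node⁺ N′≐ k (old a∈ a≢x)) λ { refl → z∉ (nodesOf⊆nodes k a∈) }
  node→ k (new a∈) with node⁻ K≐ k a∈
  ... | old a∈₁ a≢z = old (node⁺ N′≐ k (new a∈₁)) a≢z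
  ... | new a∈₂ = new a∈₂
  node← : ∀ k {a} → SubstNode (V N′) (V K₂) z k a → SubstNode (V N) (V K) x k a
  node← k (new a∈) = new (node⁺ K≐ k (new a∈))
  node← k (old a∈ a≢z) with node⁻ N′≐ k a∈
  ... | old a∈N a≢x = old a∈N a≢x
  ... | new a∈₁ = new (node⁺ K≐ k (old a∈₁ a≢z))

update : (Node → Node) → Node → Node → Node → Node
update f y z a with a ≟ y
... | yes _ = z
... | no _  = f a

update-at : ∀ f y z → update f y z y ≡ z
update-at f y z with y ≟ y
... | yes _  = refl
... | no y≢y = contradiction refl y≢y

update-away : ∀ f y z {a} → a ≢ y → update f y z a ≡ f a
update-away f y z {a} a≢y with a ≟ y
... | yes a≡y = contradiction a≡y a≢y
... | no _    = refl

map-update-away : ∀ f y z c → c ≢ just y → Maybe.map (update f y z) c ≡ Maybe.map f c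
map-update-away f y z nothing _ = refl
map-update-away f y z (just a) a≢y = cong just (update-away f y z (≢just a≢y))

-- α-conversion: the substituted node y of L, which need not be fresh for an
-- enclosing net, is replaced by z.
module AlphaConversion {L L₁ L₂ K y f z j k} (L≐ : SubstShape L₁ y L₂ L) (cp : Copy f L K)
         (wf₁ : WellFormed j L₁) (wf₂ : WellFormed k L₂) (y∈ : y ∈ nodesOf k L₁)
         (disj : Disjoint (nodes L₁) (nodes L₂)) (z∉K : z ∉ nodes K) where

  open Copy cp
  private
    f′ : Node → Node
    f′ = update f y z

    module W₁ = WellFormed wf₁
    module W₂ = WellFormed wf₂

    old∈ : ∀ {a} → a ∈ nodes L₁ → a ≢ y → a ∈ nodes L
    old∈ a∈ a≢y = let t , a∈t = nodes⊆nodesOf L₁ a∈ in nodesOf⊆nodes t (node⁺ L≐ t (old a∈t a≢y))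

    new∈ : ∀ {a} → a ∈ nodes L₂ → a ∈ nodes L
    new∈ a∈ = let t , a∈t = nodes⊆nodesOf L₂ a∈ in nodesOf⊆nodes t (node⁺ L≐ t (new a∈t))

    f≢z : ∀ {a} → a ∈ nodes L → f a ≢ z
    f≢z a∈ refl = let t , a∈t = nodes⊆nodesOf L a∈ in z∉K (nodesOf⊆nodes t (copyNode t a∈t))

    f′≡z : ∀ {a} → a ∈ nodes L₁ → f′ a ≡ z → a ≡ y
    f′≡z {a} a∈ eq with a ≟ y
    ... | yes a≡y = a≡y
    ... | no a≢y  = contradiction eq (f≢z (old∈ a∈ a≢y))

    injective₁ : InjectiveOn f′ (nodes L₁)
    injective₁ {a} {b} a∈ b∈ eq with a ≟ y | b ≟ y
    ... | yes refl | yes refl = refl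
    ... | yes refl | no b≢y   = contradiction (sym eq) (f≢z (old∈ b∈ b≢y))
    ... | no a≢y   | yes refl = contradiction eq (f≢z (old∈ a∈ a≢y))
    ... | no a≢y   | no b≢y   = injective (old∈ a∈ a≢y) (old∈ b∈ b≢y) eq

    -- Substitution removes `y` from `L₁`, and `L₂` does not contain it. So injectivity of `f` says
    -- nothing about `f y`, which may clash with a node of `K`; hence the change of `f` at `y`.
    y∉L : y ∉ nodes L
    y∉L y∈L with nodes⊆nodesOf L y∈L
    ... | t , y∈t with node⁻ L≐ t y∈t
    ... | old _ y≢y = y≢y refl
    ... | new y∈₂   = disj (nodesOf⊆nodes k y∈ , nodesOf⊆nodes t y∈₂)

  α-copy₁ : Copy f′ L₁ (rename f′ L₁)
  α-copy₁ = rename-copy injective₁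

  α-copy₂ : Copy f L₂ (rename f L₂)
  α-copy₂ = rename-copy λ a∈ b∈ → injective (new∈ a∈) (new∈ b∈)

  α-z∈ : z ∈ nodesOf k (rename f′ L₁)
  α-z∈ = subst (λ a → a ∈ nodesOf k (rename f′ L₁)) (update-at f y z) (Copy.copyNode α-copy₁ k y∈)

  α-shape : SubstShape (rename f′ L₁) z (rename f L₂) K
  α-shape = describes (λ t → mk⇔ (node→ t ∘ node⁻ shape t) (node← t)) (mk⇔ link→ link←)
    where
    V₁ V₂ : NodeType → Node → Set
    V₁ t a = a ∈ nodesOf t (rename f′ L₁)
    V₂ t a = a ∈ nodesOf t (rename f L₂)

    node→ : ∀ t {a} → CopyNode f L t a → SubstNode V₁ V₂ z t a
    node→ t (b , b∈ , refl) with node⁻ L≐ t b∈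
    ... | new b∈₂     = new (Copy.copyNode α-copy₂ t b∈₂)
    ... | old b∈₁ b≢y = old
      (subst (V₁ t) (update-away f y z b≢y) (Copy.copyNode α-copy₁ t b∈₁)) (f≢z (nodesOf⊆nodes t b∈))

    node← : ∀ t {a} → SubstNode V₁ V₂ z t a → a ∈ nodesOf t K
    node← t (new a∈) with node⁻ (Copy.shape α-copy₂) t a∈
    ... | b , b∈₂ , refl = copyNode t (node⁺ L≐ t (new b∈₂))
    node← t (old a∈ a≢z) with node⁻ (Copy.shape α-copy₁) t a∈
    ... | b , b∈₁ , refl = subst (λ a → a ∈ nodesOf t K) (sym (update-away f y z b≢y))
                             (copyNode t (node⁺ L≐ t (old b∈₁ b≢y)))
      where
      b≢y : b ≢ y
      b≢y refl = a≢z (update-at f y z)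

    ≢y : ∀ {c} → Maybe.map f′ c ≢ just z → c ≢ just y
    ≢y c≢z refl = c≢z (cong just (update-at f y z))

    ≢z : ∀ {c} → (∀ {a} → c ≡ just a → a ∈ nodes L) → Maybe.map f c ≢ just z
    ≢z {just a} a∈ eq = f≢z (a∈ refl) (just-injective eq)

    -- Away from `y` the maps `f` and `f′` agree only propositionally, so a link is given together
    -- with equations that translate its ends.
    L₁-link : ∀ {c d c′ d′} → Link L₁ c d → Maybe.map f′ c ≡ c′ → Maybe.map f′ d ≡ d′ →
              Link (rename f′ L₁) c′ d′
    L₁-link l refl refl = Copy.copyLink α-copy₁ l

    K-link : ∀ {c d c′ d′} → SubstLink (Link L₁) (Link L₂) y c d →
             Maybe.map f c ≡ c′ → Maybe.map f d ≡ d′ → Link K c′ d′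
    K-link l refl refl = copyLink (link⁺ L≐ l)

    away = map-update-away f y z

    source∈L : ∀ {c d} → SubstLink (Link L₁) (Link L₂) y c d → ∀ {a} → c ≡ just a → a ∈ nodes L
    source∈L (outer l c≢y _) refl = old∈ (W₁.source∈ l) (≢just c≢y)
    source∈L (inner l)       refl = new∈ (W₂.source∈ l)
    source∈L (enter l _)     refl = old∈ (W₁.source∈ l) λ { refl → W₁.irreflexive l }
    source∈L (leave l _)     refl = new∈ (W₂.source∈ l)

    target∈L : ∀ {c d} → SubstLink (Link L₁) (Link L₂) y c d → ∀ {a} → d ≡ just a → a ∈ nodes L
    target∈L (outer l _ d≢y) refl = old∈ (W₁.target∈ l) (≢just d≢y)
    target∈L (inner l)       refl = new∈ (W₂.target∈ l)
    target∈L (enter _ l)     refl = new∈ (W₂.target∈ l)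
    target∈L (leave _ l)     refl = old∈ (W₁.target∈ l) λ { refl → W₁.irreflexive l }

    at : Maybe.map f′ (just y) ≡ just z
    at = cong just (update-at f y z)

    copied : ∀ {c d} → SubstLink (Link L₁) (Link L₂) y c d →
             SubstLink (Link (rename f′ L₁)) (Link (rename f L₂)) z (Maybe.map f c) (Maybe.map f d)
    copied s@(outer {c} {d} l c≢y d≢y) =
      outer (L₁-link l (away c c≢y) (away d d≢y)) (≢z (source∈L s)) (≢z (target∈L s))
    copied (inner l) = inner (Copy.copyLink α-copy₂ l)
    copied s@(enter {c} l m) =
      enter (L₁-link l (away c λ { refl → y∉L (source∈L s refl) }) at) (Copy.copyLink α-copy₂ m)
    copied s@(leave {d = d} m l) =
      leave (Copy.copyLink α-copy₂ m) (L₁-link l at (away d λ { refl → y∉L (target∈L s refl) }))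

    link→ : ∀ {c d} → Link K c d → SubstLink (Link (rename f′ L₁)) (Link (rename f L₂)) z c d
    link→ l with link⁻ shape l
    ... | _ , _ , l₀ , refl , refl = copied (link⁻ L≐ l₀)

    link← : ∀ {c d} → SubstLink (Link (rename f′ L₁)) (Link (rename f L₂)) z c d → Link K c d
    link← (outer l c≢z d≢z) with link⁻ (Copy.shape α-copy₁) l
    ... | c , d , l₀ , refl , refl =
      K-link (outer l₀ (≢y c≢z) (≢y d≢z)) (sym (away c (≢y c≢z))) (sym (away d (≢y d≢z)))
    link← (inner m) with link⁻ (Copy.shape α-copy₂) m
    ... | _ , _ , m₀@(arrow _) , refl , refl = K-link (inner m₀) refl refl
    link← (enter l m) with link⁻ (Copy.shape α-copy₁) l | link⁻ (Copy.shape α-copy₂) m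
    ... | c , just b , l₀ , refl , eq | _ , _ , m₀@(input _) , refl , refl
      with refl ← f′≡z (W₁.target∈ l₀) (just-injective (sym eq)) =
      K-link (enter l₀ m₀) (sym (away c λ { refl → W₁.irreflexive l₀ })) refl
    link← (leave m l) with link⁻ (Copy.shape α-copy₁) l | link⁻ (Copy.shape α-copy₂) m
    ... | just b , c , l₀ , eq , refl | _ , _ , m₀@(output _) , refl , refl
      with refl ← f′≡z (W₁.source∈ l₀) (just-injective (sym eq)) =
      K-link (leave m₀ l₀) refl (sym (away c λ { refl → W₁.irreflexive l₀ }))

  α-node₁ : ∀ {a} → a ∈ nodes (rename f′ L₁) → a ≡ z ⊎ a ∈ nodes K
  α-node₁ {a} a∈ with a ≟ z | nodes⊆nodesOf (rename f′ L₁) a∈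
  ... | yes a≡z | _       = inj₁ a≡z
  ... | no a≢z  | t , a∈t = inj₂ (nodesOf⊆nodes t (node⁺ α-shape t (old a∈t a≢z)))

  α-node₂ : ∀ {a} → a ∈ nodes (rename f L₂) → a ∈ nodes K
  α-node₂ a∈ = let t , a∈t = nodes⊆nodesOf (rename f L₂) a∈ in nodesOf⊆nodes t (node⁺ α-shape t (new a∈t))

  α-disjoint : Disjoint (nodes (rename f′ L₁)) (nodes (rename f L₂))
  α-disjoint {a} (a∈₁ , a∈₂) with nodes⊆nodesOf (rename f′ L₁) a∈₁ | nodes⊆nodesOf (rename f L₂) a∈₂
  ... | s , p | t , q with node⁻ (Copy.shape α-copy₁) s p | node⁻ (Copy.shape α-copy₂) t q
  ... | b , b∈ , refl | c , c∈ , eq with b ≟ y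
  ... | yes refl = f≢z (new∈ (nodesOf⊆nodes t c∈)) (sym eq)
  ... | no b≢y with refl ← injective (old∈ (nodesOf⊆nodes s b∈) b≢y) (new∈ (nodesOf⊆nodes t c∈)) eq =
    disj (nodesOf⊆nodes s b∈ , nodesOf⊆nodes t c∈)

-- Contraction

module _ {N x K M i k} (M≐ : SubstShape N x K M) (wfM : WellFormed i M) (wfN : WellFormed i N)
         (wfK : WellFormed k K) (x∈ : x ∈ nodesOf k N) (disj : Disjoint (nodes N) (nodes K)) where

  private
    module WN = WellFormed wfN
    module WK = WellFormed wfK
    S = nodes K

    out : ∀ {a} → All (_∉ S) (just a) → a ∉ S
    out (just a∉) = a∉

    source-out : ∀ {c d} → Link N c d → All (_∉ S) c
    source-out {nothing} l = nothing
    source-out {just a}  l = just λ s → disj (WN.source∈ l , s)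

    target-out : ∀ {c d} → Link N c d → All (_∉ S) d
    target-out {d = nothing} l = nothing
    target-out {d = just a}  l = just λ s → disj (WN.target∈ l , s)

    x∉S : x ∉ S
    x∉S s = disj (nodesOf⊆nodes k x∈ , s)

    S⊆ : S ⊆ nodes M
    S⊆ s = let t , a∈ = nodes⊆nodesOf K s in nodesOf⊆nodes t (node⁺ M≐ t (new a∈))

    -- So `x` itself is available as the new name, and the contraction yields `N` and not a renamed
    -- variant of it.
    x∉M : x ∉ nodes M
    x∉M x∈M with nodes⊆nodesOf M x∈M
    ... | t , x∈t with node⁻ M≐ t x∈t
    ... | old _ x≢x = x≢x refl
    ... | new x∈K   = x∉S (nodesOf⊆nodes t x∈K)

    -- Disjointness of `N` and `K` leaves `enter` as the only constructor that crosses from outside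
    -- `S` into it.
    entering : ∀ {c a} → Link M c (just a) → All (_∉ S) c → a ∈ S →
               Link N c (just x) × Link K nothing (just a)
    entering l c∉ s with link⁻ M≐ l
    ... | outer r _ _ = contradiction s (out (target-out r))
    ... | inner q     = contradiction (WK.source∈ q) (out c∉)
    ... | enter r q   = r , q
    ... | leave _ r   = contradiction s (out (target-out r))

    leaving : ∀ {a d} → Link M (just a) d → a ∈ S → All (_∉ S) d →
              Link K (just a) nothing × Link N (just x) d
    leaving l s d∉ with link⁻ M≐ l
    ... | outer r _ _ = contradiction s (out (source-out r))
    ... | inner q     = contradiction (WK.target∈ q) (out d∉)
    ... | enter r _   = contradiction s (out (source-out r))
    ... | leave q r   = q , r

    ends = WellFormed.endsInNodes wfM

  restricts-to-K : Models K (M [ S ])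
  restricts-to-K = describes
    (λ t → mk⇔ (node→ t ∘ node⁻ (restrict-shape ends S) t)
               (λ a∈ → node⁺ (restrict-shape ends S) t (node⁺ M≐ t (new a∈) , nodesOf⊆nodes t a∈)))
    (mk⇔ (link→ ∘ link⁻ (restrict-shape ends S)) (link⁺ (restrict-shape ends S) ∘ link←))
    where
    node→ : ∀ t {a} → a ∈ nodesOf t M × a ∈ S → a ∈ nodesOf t K
    node→ t (a∈ , s) with node⁻ M≐ t a∈
    ... | old a∈N _ = contradiction (nodesOf⊆nodes t a∈N , s) disj
    ... | new a∈K   = a∈K
    link→ : ∀ {c d} → RestrictLink S (Link M) c d → Link K c d
    link→ (within l a∈ b∈) with link⁻ M≐ l
    ... | outer r _ _ = contradiction a∈ (out (source-out r))
    ... | inner q     = q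
    ... | enter r _   = contradiction a∈ (out (source-out r))
    ... | leave _ r   = contradiction b∈ (out (target-out r))
    link→ (entry l c∉ a∈) = proj₂ (entering l c∉ a∈)
    link→ (exit l a∈ d∉)  = proj₁ (leaving l a∈ d∉)
    link← : ∀ {c d} → Link K c d → RestrictLink S (Link M) c d
    link← q@(arrow _) = within (link⁺ M≐ (inner q)) (WK.source∈ q) (WK.target∈ q)
    -- An input of `K` is an input of the subnet only if a link enters it from outside; a
    -- predecessor of `x` in `N`, possibly the environment, provides one.
    link← q@(input _) = let _ , r = WN.predecessor k x∈ in
      entry (link⁺ M≐ (enter r q)) (source-out r) (WK.target∈ q)
    link← q@(output _) = let _ , r = WN.successor k x∈ in
      exit (link⁺ M≐ (leave q r)) (WK.source∈ q) (target-out r)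

  contracts-to-N : Models (contract k S x M) N
  contracts-to-N = describes
    (λ t → mk⇔ (node⁺ C t ∘ node→ t) (node← t ∘ node⁻ C t))
    (mk⇔ (link⁺ C ∘ link→) (link← ∘ link⁻ C))
    where
    C : Describes (ContractNode S x k (λ t a → a ∈ nodesOf t M)) (ContractLink S x (Link M)) (contract k S x M)
    C = contract-shape ends S k x
    V : NodeType → Node → Set
    V t a = a ∈ nodesOf t M
    node→ : ∀ t {a} → a ∈ nodesOf t N → ContractNode S x k V t a
    node→ t {a} a∈ with a ≟ x
    ... | no a≢x = kept (node⁺ M≐ t (old a∈ a≢x)) λ s → disj (nodesOf⊆nodes t a∈ , s)
    -- `merged` exists at type `k` only, and `x` has no other type.
    ... | yes refl with refl ← WN.disjoint k t x∈ a∈ = merged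
    node← : ∀ t {a} → ContractNode S x k V t a → a ∈ nodesOf t N
    node← t merged = x∈
    node← t (kept a∈ a∉) with node⁻ M≐ t a∈
    ... | old a∈N _ = a∈N
    ... | new a∈K   = contradiction (nodesOf⊆nodes t a∈K) a∉
    link→ : ∀ {c d} → Link N c d → ContractLink S x (Link M) c d
    link→ {c} {d} r with ≡-decᴹ _≟_ c (just x) | ≡-decᴹ _≟_ d (just x)
    ... | no c≢   | no d≢    = outer (link⁺ M≐ (outer r c≢ d≢)) (source-out r) (target-out r)
    -- A link into `x` survives in `M` only as links into inputs of `K`; any one of these contracts
    -- back to it.
    ... | no _    | yes refl = let _ , q = WK.hasInput in
      enter (link⁺ M≐ (enter r q)) (source-out r) (WK.target∈ q)
    ... | yes refl | no _    = let _ , q = WK.hasOutput in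
      leave (link⁺ M≐ (leave q r)) (WK.source∈ q) (target-out r)
    ... | yes refl | yes refl = contradiction r WN.irreflexive
    link← : ∀ {c d} → ContractLink S x (Link M) c d → Link N c d
    link← (outer l c∉ d∉) with link⁻ M≐ l
    ... | outer r _ _ = r
    ... | inner q     = contradiction (WK.source∈ q) (out c∉)
    ... | enter _ q   = contradiction (WK.target∈ q) (out d∉)
    ... | leave q _   = contradiction (WK.source∈ q) (out c∉)
    link← (enter l c∉ s) = proj₁ (entering l c∉ s)
    link← (leave l s d∉) = proj₂ (leaving l s d∉)

  contract-basic : IsBasic K → M ⇝ N
  contract-basic basicK = step k S x (proj₁ (wellFormed⁻ wfM)) contractible
    (wellFormed⁻ (copy-wellFormed cp wfK)) x∉M (models⇒≈ contracts-to-N)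
    where
    cp = models⇒copy restricts-to-K
    K-input : ∀ {a} → a ∈ I (M [ S ]) → Link K nothing (just a)
    K-input a∈ = link⁻ restricts-to-K (input a∈)
    K-output : ∀ {a} → a ∈ O (M [ S ]) → Link K (just a) nothing
    K-output a∈ = link⁻ restricts-to-K (output a∈)
    nonEmpty : S ≢ []
    nonEmpty eq with subst (_ ∈_) eq (WK.target∈ (proj₂ WK.hasInput))
    ... | ()
    contractible : IsContractible M S
    contractible = record
      { isSubnet = record { nonEmpty = nonEmpty ; S⊆nodes = S⊆ }
      ; wellNested = record
        { inputs = λ i₁ i₂ →
            -- A link from outside into one input of `K` stems from a link of `N` into `x`; pairing
            -- the latter with the other input gives the required link. As `c` may be `nothing`,
            -- this covers both clauses.
            let replace = λ {c} (l : Link M c _) c∉ → link⁺ M≐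
                  (enter (proj₁ (entering l c∉ (WK.target∈ (K-input i₂)))) (K-input i₁)) in
            (λ c∉ e → from (arrow⇔ M) (replace (arrow e) (just c∉))) ,
            (λ i → from (input⇔ M) (replace (input i) nothing))
        ; outputs = λ o₁ o₂ →
            let replace = λ {d} (l : Link M _ d) d∉ → link⁺ M≐
                  (leave (K-output o₁) (proj₂ (leaving l (WK.source∈ (K-output o₂)) d∉))) in
            (λ d∉ e → from (arrow⇔ M) (replace (arrow e) (just d∉))) ,
            (λ o → from (output⇔ M) (replace (output o) nothing))
        }
      ; isBasic = copy-basic cp basicK
      }

-- Structural recursion on the derivation for `L`. The copy and its context are arbitrary because
-- the first recursive call takes place inside `N′` and each factor has its own renaming.
reduce : ∀ {L} → IsANDOR L → ∀ {f K N M x i k} → Copy f L K →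
         WellFormed k L → WellFormed i M → WellFormed i N →
         x ∈ nodesOf k N → Disjoint (nodes N) (nodes K) → SubstShape N x K M → M ⇝* N
reduce (basic b) cp wfL wfM wfN x∈ disj M≐ =
  contract-basic M≐ wfM wfN (copy-wellFormed cp wfL) x∈ disj (copy-basic cp b) ◅ ε
reduce {L} (substitute {L₁} {L₂} t y andor₁ andor₂ isWF₁ isWF₂ disj₁₂ y∈ L≈)
  {f} {K} {N} {M} {x} {i} cp wfL wfM wfN x∈ disj M≐ =
    reduce andor₂ α-copy₂ wf₂ wfM wfN′ z∈N′ disj′ M≐′
    ◅◅ reduce andor₁ α-copy₁ wf₁ wfN′ wfN x∈ disjK₁ N′≐
  where
  L≐ : SubstShape L₁ y L₂ L
  L≐ = ≈⇒substShape L≈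
  wf₂ : WellFormed t L₂
  wf₂ = wellFormed⁺ isWF₂
  wf₁ : WellFormed _ L₁
  wf₁ = outerType L≐ wfL (proj₂ (isWF⇒wellFormed isWF₁)) wf₂ y∈ disj₁₂
  -- Freshness for `K` keeps the updated map injective; freshness for `N` permits the regrouping by
  -- `subst-assoc` and keeps `N` disjoint from `K₁`.
  z = proj₁ (fresh (nodes N ++ nodes K))
  z∉ = proj₂ (fresh (nodes N ++ nodes K))
  z∉N = λ z∈ → z∉ (∈-++⁺ˡ z∈)
  z∉K = λ z∈ → z∉ (∈-++⁺ʳ (nodes N) z∈)
  K₁ = rename (update f y z) L₁
  K₂ = rename f L₂
  open AlphaConversion L≐ cp wf₁ wf₂ y∈ disj₁₂ z∉K
  disjK₁ : Disjoint (nodes N) (nodes K₁)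
  disjK₁ (a∈N , a∈K₁) with α-node₁ a∈K₁
  ... | inj₁ refl = z∉N a∈N
  ... | inj₂ a∈K  = disj (a∈N , a∈K)
  N′ = N ⊗[ x ] K₁
  N′≐ : SubstShape N x K₁ N′
  N′≐ = ⊗-shape N x K₁
  wfN′ : WellFormed i N′
  wfN′ = subst-wellFormed N′≐ wfN (copy-wellFormed α-copy₁ wf₁) x∈ disjK₁
  z∈N′ : z ∈ nodesOf t N′
  z∈N′ = node⁺ N′≐ t (new α-z∈)
  disj′ : Disjoint (nodes N′) (nodes K₂)
  disj′ (a∈N′ , a∈K₂) with nodes⊆nodesOf N′ a∈N′
  ... | s , a∈s with node⁻ N′≐ s a∈s
  ... | old a∈N _ = disj (nodesOf⊆nodes s a∈N , α-node₂ a∈K₂)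
  ... | new a∈K₁  = α-disjoint (nodesOf⊆nodes s a∈K₁ , a∈K₂)
  M≐′ : SubstShape N′ z K₂ M
  M≐′ = subst-assoc wfN z∉N M≐ α-shape N′≐

-- One-node nets

singleton : NodeType → Node → Net
singleton place      x = net (x ∷ []) [] [] (x ∷ []) (x ∷ [])
singleton transition x = net [] (x ∷ []) [] (x ∷ []) (x ∷ [])

singleton-node : ∀ k {x} → x ∈ nodesOf k (singleton k x)
singleton-node place      = here refl
singleton-node transition = here refl

singleton-node⁻ : ∀ k s {x a} → a ∈ nodesOf s (singleton k x) → s ≡ k × a ≡ x
singleton-node⁻ place      place      (here eq) = refl , eq
singleton-node⁻ transition transition (here eq) = refl , eq

data SingletonLink (x : Node) : Rel (Maybe Node) 0ℓ where
  input  : SingletonLink x nothing (just x)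
  output : SingletonLink x (just x) nothing

singleton-link : ∀ k {x c d} → Link (singleton k x) c d ⇔ SingletonLink x c d
singleton-link place = mk⇔
  (λ { (input (here refl)) → input ; (output (here refl)) → output })
  (λ { input → input (here refl) ; output → output (here refl) })
singleton-link transition = mk⇔
  (λ { (input (here refl)) → input ; (output (here refl)) → output })
  (λ { input → input (here refl) ; output → output (here refl) })

singleton-wellFormed : ∀ k x → WellFormed k (singleton k x)
singleton-wellFormed k x = record
  { disjoint = λ s t p q → trans (proj₁ (singleton-node⁻ k s p)) (sym (proj₁ (singleton-node⁻ k t q)))
  ; bipartite = λ l → bip (to (singleton-link k) l)
  ; hasInput = x , from (singleton-link k) input
  ; hasOutput = x , from (singleton-link k) output
  ; reachable = λ t a∈ → reach (proj₂ (singleton-node⁻ k t a∈))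
  ; coreachable = λ t a∈ → coreach (proj₂ (singleton-node⁻ k t a∈))
  }
  where
  bip : ∀ {c d} → SingletonLink x c d →
        ∃[ t ] (HasType k (singleton k x) t c × HasType k (singleton k x) (opposite t) d)
  bip input  = opposite k , refl ,
    subst (λ t → x ∈ nodesOf t (singleton k x)) (sym (opposite-involutive k)) (singleton-node k)
  bip output = k , singleton-node k , refl
  reach : ∀ {a} → a ≡ x → Star (Link (singleton k x)) nothing (just a)
  reach refl = from (singleton-link k) input ◅ ε
  coreach : ∀ {a} → a ≡ x → Star (flip (Link (singleton k x))) nothing (just a)
  coreach refl = from (singleton-link k) output ◅ ε

singleton-oneNode : ∀ k x → OneNode (singleton k x)
singleton-oneNode place      x = refl
singleton-oneNode transition x = refl

-- The only links of `x` join it to the environment, so `enter` and `leave` reproduce precisely the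
-- inputs and outputs of `M`, and no `outer` link remains.
singleton-subst : ∀ {k x M j} → WellFormed j M → x ∉ nodes M → SubstShape (singleton k x) x M M
singleton-subst {k} {x} {M} wf x∉ = describes (λ t → mk⇔ new (node← t)) (mk⇔ link→ link←)
  where
  node← : ∀ t {a} → SubstNode (λ k′ a → a ∈ nodesOf k′ (singleton k x)) (λ k a → a ∈ nodesOf k M) x t a →
          a ∈ nodesOf t M
  node← t (old a∈ a≢x) = contradiction (proj₂ (singleton-node⁻ k t a∈)) a≢x
  node← t (new a∈)     = a∈
  link→ : ∀ {c d} → Link M c d → SubstLink (Link (singleton k x)) (Link M) x c d
  link→ l@(arrow _)  = inner l
  link→ l@(input _)  = enter (from (singleton-link k) input) l
  link→ l@(output _) = leave l (from (singleton-link k) output)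
  link← : ∀ {c d} → SubstLink (Link (singleton k x)) (Link M) x c d → Link M c d
  link← (inner l) = l
  link← (outer s c≢ d≢) with to (singleton-link k) s
  ... | input  = contradiction refl d≢
  ... | output = contradiction refl c≢
  link← (enter s l) with to (singleton-link k) s
  ... | input = l
  link← (leave l s) with to (singleton-link k) s
  ... | output = l

andor⇒reducible : ∀ {M} → IsWF M → IsANDOR M → ∃[ M′ ] (IsWF M′ × OneNode M′ × M ⇝* M′)
andor⇒reducible {M} isWF andor =
  singleton k x , proj₁ (wellFormed⁻ (singleton-wellFormed k x)) , singleton-oneNode k x ,
  reduce andor copy-refl wf wf (singleton-wellFormed k x) (singleton-node k) disj (singleton-subst wf x∉)
  where
  k = proj₁ (isWF⇒wellFormed isWF)
  wf = proj₂ (isWF⇒wellFormed isWF)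
  x = proj₁ (fresh (nodes M))
  x∉ = proj₂ (fresh (nodes M))
  disj : Disjoint (nodes (singleton k x)) (nodes M)
  disj (a∈ , a∈M) with nodes⊆nodesOf (singleton k x) a∈
  ... | t , a∈t with singleton-node⁻ k t a∈t
  ... | _ , refl = x∉ a∈M

-- Bipartiteness forbids a loop, so the node has no arrows and is both input and output. Of the two
-- basic classes of each type, the one chosen does not count inputs and outputs.
oneNode-basic : ∀ {M} → IsWF M → OneNode M → IsBasic M
oneNode-basic {M} isWF one with isWF⇒wellFormed isWF | card≡1⁻ (nodes M) one
... | k , wf | a , a∈ , only = byType k wf
  where
  open WellFormed
  module _ {k} (wf : WellFormed k M) where
    noArrow : ∀ {b c} → ¬ Link M (just b) (just c)
    noArrow l with refl ← only (source∈ wf l) | refl ← only (target∈ wf l) = irreflexive wf l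
    acyclic : Acyclic M
    acyclic _ Trans.[ e ] = noArrow (arrow e)
    acyclic _ (e ∷ _) = noArrow (arrow e)
    unique : ∀ {b} → b ∈ nodes M → UniqueInOut M b
    unique b∈ with refl ← only b∈ | hasInput wf | hasOutput wf
    ... | _ , i | _ , o with refl ← only (target∈ wf i) | refl ← only (source∈ wf o) = uniqueLinks⁻
      ( (nothing , i , λ { {nothing} _ → refl ; {just _} l → contradiction l noArrow })
      , (nothing , o , λ { {nothing} _ → refl ; {just _} l → contradiction l noArrow }))
  byType : ∀ k → WellFormed k M → IsBasic M
  byType place      wf = pAND (isWF , acyclic wf , λ p → unique wf (nodesOf⊆nodes place {M} p))
                              (wellFormed⁻ {place} wf)
  byType transition wf = tOR (isWF , λ t → unique wf (nodesOf⊆nodes transition {M} t))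
                             (wellFormed⁻ {transition} wf)

-- Contraction as inverse substitution

module Contraction {M k S n M′} {j} (wf : WellFormed j M) (nested : WellNested M S)
         (n∉ : n ∉ nodes M) (M′≈ : M′ ≈ contract k S n M) where

  private
    ends = WellFormed.endsInNodes wf
    C : Describes (ContractNode S n k (λ t a → a ∈ nodesOf t M)) (ContractLink S n (Link M)) M′
    C = describes-resp (≈⇒models M′≈) (contract-shape ends S k n)
    R : Describes (λ k a → a ∈ nodesOf k M × a ∈ S) (RestrictLink S (Link M)) (M [ S ])
    R = restrict-shape ends S

    ≢n : ∀ {a} → a ∈ nodes M → a ≢ n
    ≢n a∈ refl = n∉ a∈

    -- The two input clauses of `WellNested` become one statement about a link from `c`, environment
    -- included. The link `l` itself shows that `b` is an input of the subnet.
    nested-in : ∀ {c a b} → Link M c (just b) → All (_∉ S) c → b ∈ S →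
                RestrictLink S (Link M) nothing (just a) → Link M c (just a)
    nested-in l c∉ b∈ r =
      case l c∉ (WellNested.inputs nested (I∈ r) (I∈ (entry l c∉ b∈)))
      where
      I∈ : ∀ {a} → RestrictLink S (Link M) nothing (just a) → a ∈ I (M [ S ])
      I∈ r = from (input⇔ (M [ S ])) (link⁺ R r)
      case : ∀ {c a b} → Link M c (just b) → All (_∉ S) c →
             (∀ {n₃} → n₃ ∉ S → (n₃ , b) ∈ F M → (n₃ , a) ∈ F M) × (b ∈ I M → a ∈ I M) →
             Link M c (just a)
      case (arrow e) (just c∉) (f , _) = arrow (f c∉ e)
      case (input i) _         (_ , g) = input (g i)

    nested-out : ∀ {a b d} → Link M (just b) d → b ∈ S → All (_∉ S) d →
                 RestrictLink S (Link M) (just a) nothing → Link M (just a) d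
    nested-out l b∈ d∉ r =
      case l d∉ (WellNested.outputs nested (O∈ r) (O∈ (exit l b∈ d∉)))
      where
      O∈ : ∀ {a} → RestrictLink S (Link M) (just a) nothing → a ∈ O (M [ S ])
      O∈ r = from (output⇔ (M [ S ])) (link⁺ R r)
      case : ∀ {a b d} → Link M (just b) d → All (_∉ S) d →
             (∀ {n₃} → n₃ ∉ S → (b , n₃) ∈ F M → (a , n₃) ∈ F M) × (b ∈ O M → a ∈ O M) →
             Link M (just a) d
      case (arrow e)  (just d∉) (f , _) = arrow (f d∉ e)
      case (output o) _         (_ , g) = output (g o)

  contract-expands : SubstShape M′ n (M [ S ]) M
  contract-expands = describes (λ t → mk⇔ (node→ t) (node← t)) (mk⇔ link→ link←)
    where
    V V′ : NodeType → Node → Set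
    V t a = a ∈ nodesOf t M′
    V′ t a = a ∈ nodesOf t (M [ S ])
    node→ : ∀ t {a} → a ∈ nodesOf t M → SubstNode V V′ n t a
    node→ t {a} a∈ with a ∈? S
    ... | yes s = new (node⁺ R t (a∈ , s))
    ... | no a∉ = old (node⁺ C t (kept a∈ a∉)) (≢n (nodesOf⊆nodes t a∈))
    node← : ∀ t {a} → SubstNode V V′ n t a → a ∈ nodesOf t M
    node← t (new a∈) = proj₁ (node⁻ R t a∈)
    node← t (old a∈ a≢n) with node⁻ C t a∈
    ... | kept a∈M _ = a∈M
    ... | merged     = contradiction refl a≢n

    inside? : ∀ c → ∃[ a ] (c ≡ just a × a ∈ S) ⊎ All (_∉ S) c
    inside? nothing = inj₂ nothing
    inside? (just a) with a ∈? S
    ... | yes s = inj₁ (a , refl , s)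
    ... | no a∉ = inj₂ (just a∉)
    source≢n : ∀ {c d} → Link M c d → c ≢ just n
    source≢n l refl = n∉ (WellFormed.source∈ wf l)
    target≢n : ∀ {c d} → Link M c d → d ≢ just n
    target≢n l refl = n∉ (WellFormed.target∈ wf l)

    link→ : ∀ {c d} → Link M c d → SubstLink (Link M′) (Link (M [ S ])) n c d
    link→ {c} {d} l with inside? c | inside? d
    ... | inj₁ (_ , refl , a∈) | inj₁ (_ , refl , b∈) = inner (link⁺ R (within l a∈ b∈))
    ... | inj₂ c∉ | inj₁ (_ , refl , b∈) = enter (link⁺ C (enter l c∉ b∈)) (link⁺ R (entry l c∉ b∈))
    ... | inj₁ (_ , refl , a∈) | inj₂ d∉ = leave (link⁺ R (exit l a∈ d∉)) (link⁺ C (leave l a∈ d∉))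
    ... | inj₂ c∉ | inj₂ d∉ = outer (link⁺ C (outer l c∉ d∉)) (source≢n l) (target≢n l)

    link← : ∀ {c d} → SubstLink (Link M′) (Link (M [ S ])) n c d → Link M c d
    link← (outer r c≢ d≢) with link⁻ C r
    ... | outer l _ _ = l
    ... | enter _ _ _ = contradiction refl d≢
    ... | leave _ _ _ = contradiction refl c≢
    link← (inner r) with link⁻ R r
    ... | within l _ _ = l
    link← (enter r q) with link⁻ C r
    ... | outer l _ _    = contradiction refl (target≢n l)
    -- Contraction remembers only that `c` has a link to some `b` in `S`, while substitution joins
    -- `c` to every input of the subnet. Well-nestedness bridges this gap.
    ... | enter l c∉ b∈  = nested-in l c∉ b∈ (link⁻ R q)
    ... | leave l _ _    = contradiction refl (target≢n l)
    link← (leave q r) with link⁻ C r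
    ... | outer l _ _    = contradiction refl (source≢n l)
    ... | enter l _ _    = contradiction refl (source≢n l)
    ... | leave l b∈ d∉  = nested-out l b∈ d∉ (link⁻ R q)

  contract-disjoint : Disjoint (nodes M′) (nodes (M [ S ]))
  contract-disjoint (a∈ , a∈S) with nodes⊆nodesOf M′ a∈ | nodes⊆nodesOf (M [ S ]) a∈S
  ... | s , p | t , q with node⁻ C s p | node⁻ R t q
  ... | kept _ a∉ | _ , s∈    = a∉ s∈
  ... | merged    | n∈t , _   = n∉ (nodesOf⊆nodes t n∈t)

  contract-node : n ∈ nodesOf k M′
  contract-node = node⁺ C k merged

expand : ∀ {M M′} → M ⇝ M′ → IsWF M′ → IsANDOR M′ → IsANDOR M
expand (step k S n isWF contr isWF′ n∉ M′≈) wfM′ andor =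
  substitute k n andor (basic (IsContractible.isBasic contr)) wfM′ isWF′
    contract-disjoint contract-node (substShape⇒≈ contract-expands)
  where
  open Contraction (proj₂ (isWF⇒wellFormed isWF)) (IsContractible.wellNested contr) n∉ M′≈

expand* : ∀ {M M′} → M ⇝* M′ → IsWF M′ → IsANDOR M′ → IsANDOR M
expand* ε _ andor = andor
expand* (s ◅ ε) wf andor = expand s wf andor
-- `expand` needs the contracted net to be WF; for an intermediate net this is read off the next
-- step, which starts from it.
expand* (s ◅ p@(step _ _ _ wf _ _ _ _ ◅ _)) wf′ andor = expand s wf (expand* p wf′ andor)

theorem65 : (M : Net) → IsWF M →
    IsANDOR M ⇔ (∃[ M′ ] (IsWF M′ × OneNode M′ × M ⇝* M′))
theorem65 M wf = mk⇔ (andor⇒reducible wf)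
  (λ { (_ , wf′ , one , p) → expand* p wf′ (basic (oneNode-basic wf′ one)) })
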